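{- Let $k$ be a positive integer. Let $K_1, K_2, \dots, K_k$ be distinct imaginary quadratic fields other than $\mathbb{Q}(\sqrt{ -1})$. Then there exists a positive integer $n$ such that $I_{2n}^{2,i}$ contains a primitive element (over $\mathbb{Q}$) of every $K_i$, $i \in \{1,2,\dots,k\}$.
   Context: An imaginary quadratic field is a subfield of $\mathbb{C}$ of degree two over $\mathbb{Q}$ not contained in $\mathbb{R}$. For a positive integer $c$, $\sqrt{ -c}$ denotes $\sqrt{c}\,\sqrt{ -1}$. For an even integer $n \ge 2$, $$I_n^{2,i} := \left\{\sqrt{ -c} \in \mathbb{C}\setminus\mathbb{R} \;\middle|\; c \in \mathbb{Z},\ \left(\tfrac{n}{2}\right)^2 < c < \left(\tfrac{n}{2}+1\right)^2\right\}.$$ -}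

module Defs where

open import Level using (Level; 0ℓ) renaming (suc to lsuc)
open import Algebra.Bundles.Raw using (RawMonoid)
import Algebra.Definitions.RawMonoid as RawMonoidDefinitions
open import Data.Integer.Base as ℤ using (ℤ; +_)
open import Data.Nat.Base as ℕ using (ℕ)
import Data.Nat.Properties as ℕ
open import Data.Product.Base using (Σ-syntax; ∃-syntax; _×_; _,_)
open import Data.Rational.Base as ℚ using (ℚ; 0ℚ; 1ℚ; ½; _+_; _*_; _-_; -_; ∣_∣; _<_; _≤_)
import Data.Rational.Properties as ℚ
open import Data.Rational.Solver using (module +-*-Solver)
open import Data.Vec.Functional using (Vector)
open import Relation.Binary.PropositionalEquality using (_≡_; refl; sym; trans; cong; cong₂; subst)
open import Relation.Nullary.Negation using (¬_)
open import Relation.Unary using (Pred; _∈_; _⊆_; _≐_)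

private variable
  ℓ : Level

-- Real numbers are Cauchy sequences of rationals; _≈ᴿ_ below identifies
-- sequences whose difference tends to 0.

IsCauchy : (ℕ → ℚ) → Set
IsCauchy x = ∀ ε → 0ℚ < ε → ∃[ N ] (∀ m n → N ℕ.≤ m → N ℕ.≤ n → ∣ x m - x n ∣ < ε)

record ℝ : Set where
  constructor mkℝ
  field
    seq    : ℕ → ℚ
    cauchy : IsCauchy seq

open ℝ public

module CauchyLemmas where

  module Identities where
    open +-*-Solver

    sum-diff : ∀ a b c d → (a + b) - (c + d) ≡ (a - c) + (b - d)
    sum-diff = solve 4 (λ a b c d → (a :+ b) :- (c :+ d) := (a :- c) :+ (b :- d)) refl

    split : ∀ a b → a ≡ (a - b) + b
    split = solve 2 (λ a b → a := (a :- b) :+ b) refl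

    product-diff : ∀ a b c d → a * b - c * d ≡ a * (b - d) + d * (a - c)
    product-diff = solve 4 (λ a b c d → a :* b :- c :* d := a :* (b :- d) :+ d :* (a :- c)) refl

  open Identities
  open ℚ.≤-Reasoning

  half-pos : ∀ {ε} → 0ℚ < ε → 0ℚ < ½ * ε
  half-pos {ε} 0<ε = subst (_< ½ * ε) (ℚ.*-zeroʳ ½) (ℚ.*-monoʳ-<-pos ½ 0<ε)

  half+half : ∀ ε → ½ * ε + ½ * ε ≡ ε
  half+half ε = trans (sym (ℚ.*-distribʳ-+ ε ½ ½)) (ℚ.*-identityˡ ε)

  0<1 : 0ℚ < 1ℚ
  0<1 = ℚ.positive⁻¹ 1ℚ

  *-mono-< : ∀ {p q r s} → 0ℚ ≤ p → p < q → 0ℚ ≤ r → r < s → p * r < q * s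
  *-mono-< {p} {q} {r} {s} 0≤p p<q 0≤r r<s = ℚ.≤-<-trans
    (ℚ.*-monoˡ-≤-nonNeg p {{ℚ.nonNegative 0≤p}} (ℚ.<⇒≤ r<s))
    (ℚ.*-monoˡ-<-pos s {{ℚ.positive (ℚ.≤-<-trans 0≤r r<s)}} p<q)

  rescale : ∀ {b ε} → 0ℚ < b → 0ℚ < ε → Σ[ δ ∈ ℚ ] (0ℚ < δ × b * δ ≡ ε)
  rescale {b} {ε} 0<b 0<ε = ε * ℚ.1/ b , 0<δ , trans (ℚ.*-comm b _)
      (trans (ℚ.*-assoc ε _ b) (trans (cong (ε *_) (ℚ.*-inverseˡ b)) (ℚ.*-identityʳ ε)))
    where
    instance
      posb : ℚ.Positive b
      posb = ℚ.positive 0<b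

      nonZero : ℚ.NonZero b
      nonZero = ℚ.pos⇒nonZero b

    0<δ : 0ℚ < ε * ℚ.1/ b
    0<δ = ℚ.positive⁻¹ _ {{ℚ.pos*pos⇒pos ε {{ℚ.positive 0<ε}} (ℚ.1/ b) {{ℚ.1/pos⇒pos b}}}}

  const-cauchy : ∀ q → IsCauchy (λ _ → q)
  const-cauchy q ε 0<ε = 0 , λ _ _ _ _ →
    subst (_< ε) (sym (cong ∣_∣ (ℚ.+-inverseʳ q))) 0<ε

  +-cauchy : ∀ x y → IsCauchy x → IsCauchy y → IsCauchy (λ n → x n + y n)
  +-cauchy x y cx cy ε 0<ε =
    let M , hx = cx (½ * ε) (half-pos 0<ε)
        N , hy = cy (½ * ε) (half-pos 0<ε)
    in M ℕ.⊔ N , λ m n p q → begin-strict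
      ∣ (x m + y m) - (x n + y n) ∣    ≡⟨ cong ∣_∣ (sum-diff (x m) (y m) (x n) (y n)) ⟩
      ∣ (x m - x n) + (y m - y n) ∣    ≤⟨ ℚ.∣p+q∣≤∣p∣+∣q∣ (x m - x n) (y m - y n) ⟩
      ∣ x m - x n ∣ + ∣ y m - y n ∣    <⟨ ℚ.+-mono-<
                                            (hx m n (ℕ.m⊔n≤o⇒m≤o M N p) (ℕ.m⊔n≤o⇒m≤o M N q))
                                            (hy m n (ℕ.m⊔n≤o⇒n≤o M N p) (ℕ.m⊔n≤o⇒n≤o M N q)) ⟩
      ½ * ε + ½ * ε                    ≡⟨ half+half ε ⟩
      ε                                ∎

  neg-cauchy : ∀ x → IsCauchy x → IsCauchy (λ n → - x n)
  neg-cauchy x cx ε 0<ε =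
    let N , hx = cx ε 0<ε
    in N , λ m n p q → begin-strict
      ∣ - x m - (- x n) ∣    ≡⟨ cong ∣_∣ (ℚ.neg-distrib-+ (x m) (- x n)) ⟨
      ∣ - (x m - x n) ∣      ≡⟨ ℚ.∣-p∣≡∣p∣ (x m - x n) ⟩
      ∣ x m - x n ∣          <⟨ hx m n p q ⟩
      ε                      ∎

  eventually-bounded : ∀ x → IsCauchy x →
    Σ[ B ∈ ℚ ] Σ[ N ∈ ℕ ] (0ℚ < B × (∀ n → N ℕ.≤ n → ∣ x n ∣ < B))
  eventually-bounded x cx =
    let N , hx = cx 1ℚ 0<1
    in 1ℚ + ∣ x N ∣ , N , ℚ.+-mono-<-≤ 0<1 (ℚ.0≤∣p∣ (x N)) , λ n p → begin-strict
      ∣ x n ∣                  ≡⟨ cong ∣_∣ (split (x n) (x N)) ⟩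
      ∣ (x n - x N) + x N ∣    ≤⟨ ℚ.∣p+q∣≤∣p∣+∣q∣ (x n - x N) (x N) ⟩
      ∣ x n - x N ∣ + ∣ x N ∣  <⟨ ℚ.+-monoˡ-< ∣ x N ∣ (hx n N p ℕ.≤-refl) ⟩
      1ℚ + ∣ x N ∣             ∎

  product-close : ∀ a b c d {A B δ ε} → ∣ a ∣ < A → ∣ d ∣ < B → ∣ b - d ∣ < δ → ∣ a - c ∣ < δ →
    (A + B) * δ ≡ ε → ∣ a * b - c * d ∣ < ε
  product-close a b c d {A} {B} {δ} {ε} a<A d<B bd<δ ac<δ eq = begin-strict
    ∣ a * b - c * d ∣                          ≡⟨ cong ∣_∣ (product-diff a b c d) ⟩
    ∣ a * (b - d) + d * (a - c) ∣              ≤⟨ ℚ.∣p+q∣≤∣p∣+∣q∣ (a * (b - d)) (d * (a - c)) ⟩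
    ∣ a * (b - d) ∣ + ∣ d * (a - c) ∣          ≡⟨ cong₂ _+_ (ℚ.∣p*q∣≡∣p∣*∣q∣ a (b - d)) (ℚ.∣p*q∣≡∣p∣*∣q∣ d (a - c)) ⟩
    ∣ a ∣ * ∣ b - d ∣ + ∣ d ∣ * ∣ a - c ∣      <⟨ ℚ.+-mono-<
                                                    (*-mono-< (ℚ.0≤∣p∣ a) a<A (ℚ.0≤∣p∣ (b - d)) bd<δ)
                                                    (*-mono-< (ℚ.0≤∣p∣ d) d<B (ℚ.0≤∣p∣ (a - c)) ac<δ) ⟩
    A * δ + B * δ                              ≡⟨ ℚ.*-distribʳ-+ δ A B ⟨
    (A + B) * δ                                ≡⟨ eq ⟩
    ε                                          ∎

  ⊔⁴-bounds : ∀ K L M N {i} → (K ℕ.⊔ L) ℕ.⊔ (M ℕ.⊔ N) ℕ.≤ i →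
    K ℕ.≤ i × L ℕ.≤ i × M ℕ.≤ i × N ℕ.≤ i
  ⊔⁴-bounds K L M N p =
    let kl = ℕ.m⊔n≤o⇒m≤o (K ℕ.⊔ L) (M ℕ.⊔ N) p
        mn = ℕ.m⊔n≤o⇒n≤o (K ℕ.⊔ L) (M ℕ.⊔ N) p
    in ℕ.m⊔n≤o⇒m≤o K L kl , ℕ.m⊔n≤o⇒n≤o K L kl , ℕ.m⊔n≤o⇒m≤o M N mn , ℕ.m⊔n≤o⇒n≤o M N mn

  *-cauchy : ∀ x y → IsCauchy x → IsCauchy y → IsCauchy (λ n → x n * y n)
  *-cauchy x y cx cy ε 0<ε =
    let A , K , 0<A , bx = eventually-bounded x cx
        B , L , 0<B , by = eventually-bounded y cy
        δ , 0<δ , eq     = rescale (ℚ.+-mono-< 0<A 0<B) 0<ε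
        M , hx           = cx δ 0<δ
        N , hy           = cy δ 0<δ
    in (K ℕ.⊔ L) ℕ.⊔ (M ℕ.⊔ N) , λ m n p q →
      let K≤m , _   , M≤m , N≤m = ⊔⁴-bounds K L M N p
          _   , L≤n , M≤n , N≤n = ⊔⁴-bounds K L M N q
      in product-close (x m) (y m) (x n) (y n) (bx m K≤m) (by n L≤n) (hy m n N≤m N≤n) (hx m n M≤m M≤n) eq

open CauchyLemmas using (const-cauchy; +-cauchy; neg-cauchy; *-cauchy)

infix  4 _≈ᴿ_ _≤ᴿ_
infixl 6 _+ᴿ_
infixl 7 _*ᴿ_
infix  8 -ᴿ_

record _≈ᴿ_ (x y : ℝ) : Set where
  constructor mk≈ᴿ
  field
    close : ∀ ε → 0ℚ < ε → ∃[ N ] (∀ n → N ℕ.≤ n → ∣ seq x n - seq y n ∣ < ε)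

record _≤ᴿ_ (x y : ℝ) : Set where
  constructor mk≤ᴿ
  field
    below : ∀ ε → 0ℚ < ε → ∃[ N ] (∀ n → N ℕ.≤ n → seq x n < seq y n + ε)

fromℚ : ℚ → ℝ
fromℚ q = mkℝ (λ _ → q) (const-cauchy q)

fromℤ : ℤ → ℝ
fromℤ c = fromℚ (c ℚ./ 1)

0ᴿ 1ᴿ : ℝ
0ᴿ = fromℚ 0ℚ
1ᴿ = fromℚ 1ℚ

_+ᴿ_ _*ᴿ_ : ℝ → ℝ → ℝ
seq    (x +ᴿ y) n = seq x n + seq y n
cauchy (x +ᴿ y)   = +-cauchy (seq x) (seq y) (cauchy x) (cauchy y)
seq    (x *ᴿ y) n = seq x n * seq y n
cauchy (x *ᴿ y)   = *-cauchy (seq x) (seq y) (cauchy x) (cauchy y)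

-ᴿ_ : ℝ → ℝ
seq    (-ᴿ x) n = - seq x n
cauchy (-ᴿ x)   = neg-cauchy (seq x) (cauchy x)

record ℂ : Set where
  constructor _+i_
  field
    re im : ℝ

open ℂ public

infix  4 _≈_
infixl 6 _+ᶜ_
infixl 7 _*ᶜ_
infix  8 -ᶜ_

record _≈_ (z w : ℂ) : Set where
  constructor mk≈
  field
    re≈ : re z ≈ᴿ re w
    im≈ : im z ≈ᴿ im w

fromℝ : ℝ → ℂ
fromℝ x = x +i 0ᴿ

0ᶜ 1ᶜ 𝕚 : ℂ
0ᶜ = fromℝ 0ᴿ
1ᶜ = fromℝ 1ᴿ
𝕚  = 0ᴿ +i 1ᴿ

_+ᶜ_ _*ᶜ_ : ℂ → ℂ → ℂ
re (z +ᶜ w) = re z +ᴿ re w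
im (z +ᶜ w) = im z +ᴿ im w
re (z *ᶜ w) = re z *ᴿ re w +ᴿ -ᴿ (im z *ᴿ im w)
im (z *ᶜ w) = re z *ᴿ im w +ᴿ im z *ᴿ re w

-ᶜ_ : ℂ → ℂ
re (-ᶜ z) = -ᴿ re z
im (-ᶜ z) = -ᴿ im z

IsReal : Pred ℂ 0ℓ
IsReal z = im z ≈ᴿ 0ᴿ

-- s is √c. The nonnegative square root is unique up to _≈ᴿ_.
_IsRealSqrtOf_ : ℝ → ℤ → Set
s IsRealSqrtOf c = 0ᴿ ≤ᴿ s × s *ᴿ s ≈ᴿ fromℤ c

-- z is √-c, that is √c √-1.
_IsSqrtOfNeg_ : ℂ → ℤ → Set
z IsSqrtOfNeg c = ∃[ s ] (s IsRealSqrtOf c × z ≈ fromℝ s *ᶜ 𝕚)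

-- A subset of ℂ is a predicate respecting _≈_.

record IsSubfield (K : Pred ℂ ℓ) : Set ℓ where
  field
    resp       : ∀ {z w} → z ≈ w → z ∈ K → w ∈ K
    0∈         : 0ᶜ ∈ K
    1∈         : 1ᶜ ∈ K
    +-closed   : ∀ {z w} → z ∈ K → w ∈ K → z +ᶜ w ∈ K
    neg-closed : ∀ {z} → z ∈ K → -ᶜ z ∈ K
    *-closed   : ∀ {z w} → z ∈ K → w ∈ K → z *ᶜ w ∈ K
    inverse    : ∀ {z} → z ∈ K → ¬ (z ≈ 0ᶜ) → ∃[ w ] (w ∈ K × z *ᶜ w ≈ 1ᶜ)

+-0-rawMonoid : RawMonoid 0ℓ 0ℓ
+-0-rawMonoid = record { Carrier = ℂ ; _≈_ = _≈_ ; _∙_ = _+ᶜ_ ; ε = 0ᶜ }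

open RawMonoidDefinitions +-0-rawMonoid public using () renaming (sum to ∑)

linComb : ∀ {d} → Vector ℚ d → Vector ℂ d → ℂ
linComb q b = ∑ (λ i → fromℝ (fromℚ (q i)) *ᶜ b i)

record IsℚBasis {d} (K : Pred ℂ ℓ) (b : Vector ℂ d) : Set ℓ where
  field
    members     : ∀ i → b i ∈ K
    spanning    : ∀ {z} → z ∈ K → ∃[ q ] z ≈ linComb q b
    independent : ∀ q → linComb q b ≈ 0ᶜ → ∀ i → q i ≡ 0ℚ

HasDegree : Pred ℂ ℓ → ℕ → Set ℓ
HasDegree K d = ∃[ b ] IsℚBasis {d = d} K b

record ImaginaryQuadraticField (ℓ : Level) : Set (lsuc ℓ) where
  field
    carrier    : Pred ℂ ℓ
    isSubfield : IsSubfield carrier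
    quadratic  : HasDegree carrier 2
    imaginary  : ¬ (carrier ⊆ IsReal)

open ImaginaryQuadraticField public using (carrier)

-- The smallest subfield of ℂ containing z (and hence ℚ).
data ℚ⟮_⟯ (z : ℂ) : Pred ℂ 0ℓ where
  rational  : ∀ q → fromℝ (fromℚ q) ∈ ℚ⟮ z ⟯
  generator : z ∈ ℚ⟮ z ⟯
  sum       : ∀ {u v} → u ∈ ℚ⟮ z ⟯ → v ∈ ℚ⟮ z ⟯ → u +ᶜ v ∈ ℚ⟮ z ⟯
  negative  : ∀ {u} → u ∈ ℚ⟮ z ⟯ → -ᶜ u ∈ ℚ⟮ z ⟯
  product   : ∀ {u v} → u ∈ ℚ⟮ z ⟯ → v ∈ ℚ⟮ z ⟯ → u *ᶜ v ∈ ℚ⟮ z ⟯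
  inverse   : ∀ {u v} → u ∈ ℚ⟮ z ⟯ → u *ᶜ v ≈ 1ᶜ → v ∈ ℚ⟮ z ⟯
  respects  : ∀ {u v} → u ≈ v → u ∈ ℚ⟮ z ⟯ → v ∈ ℚ⟮ z ⟯

_IsPrimitiveElementOf_ : ℂ → Pred ℂ ℓ → Set ℓ
z IsPrimitiveElementOf K = ℚ⟮ z ⟯ ≐ K

-- The set I_n^{2,i}. It is only meant for even n, where n ℕ./ 2 is exact.
I²ⁱ : ℕ → Pred ℂ 0ℓ
I²ⁱ n z = ¬ IsReal z ×
  ∃[ c ] (+ (h ℕ.^ 2) ℤ.< c × c ℤ.< + ((h ℕ.+ 1) ℕ.^ 2) × z IsSqrtOfNeg c)
  where
  h : ℕ
  h = n ℕ./ 2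

-- Write Kᵢ = ℚ(√-dᵢ) with a positive integer dᵢ; as Kᵢ ≠ ℚ(√-1), √dᵢ is irrational. The
-- claim is then that some n ≥ 1 and integers bᵢ satisfy n < bᵢ √dᵢ < n + 1 for all i.
-- For T ⊆ {1, …, k} let d_T be the product of the dᵢ with i ∈ T. Dirichlet's pigeonhole
-- argument yields N and integers m_T such that all u_T = m_T √d_T are close to N. Put
-- A = ∑ u_T² and Bᵢ = ∑ u_T u_{T Δ {i}}. Then A is an integer, Bᵢ = bᵢ √dᵢ for an integer bᵢ,
-- and A - Bᵢ = ½ ∑ (u_T - u_{T Δ {i}})² is nonnegative, small, and nonzero because √dᵢ is
-- irrational. Hence n = A - 1 works for all i.
module Submission where

open import Algebra.Bundles using (CommutativeRing)
import Algebra.Solver.Ring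
import Algebra.Solver.Ring.AlmostCommutativeRing as ACR
open import Algebra.Structures using (IsCommutativeRing)
open import Data.Bool.Base using (not)
open import Data.Fin.Base using (Fin; zero; suc; toℕ; combine)
import Data.Fin.Properties as Fin
open import Data.Fin.Subset using (Subset; inside; outside)
open import Data.Integer.Base as ℤ using (ℤ)
import Data.Integer.Properties as ℤ
open import Data.Maybe.Base as Maybe using (Maybe)
open import Data.Nat.Base as ℕ using (ℕ; zero; suc)
open import Data.Nat.DivMod using (_mod_; m*n/n≡m)
import Data.Nat.Properties as ℕ
open import Data.Product.Base as Product using (∃-syntax; _×_; _,_; proj₁; proj₂)
open import Data.Rational.Base as ℚ using (ℚ; mkℚ; 0ℚ; 1ℚ; ½; ↥_; ↧_; toℚᵘ)
import Data.Rational.Properties as ℚ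
open import Data.Rational.Solver using (module +-*-Solver)
open import Data.Rational.Unnormalised.Base as ℚᵘ using (mkℚᵘ; _≃_; *≡*)
import Data.Rational.Unnormalised.Properties as ℚᵘ
open import Data.Sum.Base using (_⊎_; inj₁; inj₂; [_,_]′)
open import Data.Vec.Base using ([]; _∷_; replicate; updateAt)
open import Data.Vec.Functional using (Vector)
open import Function.Base using (_∘_)
open import Level using (Level)
open import Relation.Binary.PropositionalEquality as ≡ using (_≡_; _≢_; cong)
open import Relation.Binary.Structures using (IsEquivalence)
open import Relation.Nullary.Decidable using (Dec; yes; no; dec⇒maybe)
open import Relation.Nullary.Negation using (¬_; contradiction)
open import Relation.Unary using (Pred; _∈_; _⊆_; _≐_)

-- The obstacle is the side. The pigeonhole brings a multiple of every √dᵢ close to one common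
-- integer, but does not tell which of these multiples lie below it. The symmetrised sums settle
-- this: A is a sum of arithmetic means and Bᵢ the sum of the corresponding geometric means, so A -
-- Bᵢ has the same sign for every i. The approximations are indexed by subsets because the index set
-- has to be closed under toggling each i. With K = 2^k summands, an error of at most 1/2K in each
-- mean keeps A - Bᵢ at most ½, and an error of at most N/2K in each u_T² ensures this. No square
-- root is constructed. In the search for n, the inequality p √d ≤ q √e is read as p² d ≤ q² e, so
-- that everything takes place in ℕ. On the side of the fields, √dᵢ is, up to sign and a rational
-- factor, the imaginary part of a generator of Kᵢ whose square is rational.

-- Inequalities between multiples of square roots, in ℕ.

module SquareGaps where

  open import Data.Nat.Base using (pred; _+_; _*_; _∸_; _^_; _≤_; _<_; z≤n; s≤s; NonZero; >-nonZero)
  open import Data.Nat.DivMod using (_/_; _%_; m≡m%n+[m/n]*n; /-monoˡ-≤)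
  open import Data.Nat.Properties
  open import Data.Nat.Tactic.RingSolver using (solve-∀)
  open ≡ using (refl; sym; trans; cong₂; subst; subst₂)

  -- The comparisons of the real numbers p √d and q √e.
  infix 4 _√_⊑_√_ _√_⊏_√_
  _√_⊑_√_ _√_⊏_√_ : ℕ → ℕ → ℕ → ℕ → Set
  p √ d ⊑ q √ e = p * p * d ≤ q * q * e
  p √ d ⊏ q √ e = p * p * d < q * q * e

  square-cancel-≤ : ∀ m n → m * m ≤ n * n → m ≤ n
  square-cancel-≤ m n m²≤n² with m ≤? n
  ... | yes m≤n = m≤n
  ... | no  m≰n = contradiction m²≤n² (<⇒≱ (*-mono-< (≰⇒> m≰n) (≰⇒> m≰n)))

  private
    square-of-sum : ∀ p p′ d → (p + p′) * (p + p′) * d ≡ p * p * d + p′ * p′ * d + 2 * (p * p′ * d)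
    square-of-sum = solve-∀

    square-of-product : ∀ p p′ d → p * p * d * (p′ * p′ * d) ≡ p * p′ * d * (p * p′ * d)
    square-of-product = solve-∀

  module _ {d e : ℕ} where

    -- Squaring turns the claim into the product of the two hypotheses. This mixed term is what
    -- remains to be compared when two such inequalities are added and squared.
    cross-term : ∀ p q p′ q′ → p √ d ⊑ q √ e → p′ √ d ⊑ q′ √ e → p * p′ * d ≤ q * q′ * e
    cross-term p q p′ q′ h h′ = square-cancel-≤ _ _
      (subst₂ _≤_ (square-of-product p p′ d) (square-of-product q q′ e) (*-mono-≤ h h′))

    ⊑-+ : ∀ p q p′ q′ → p √ d ⊑ q √ e → p′ √ d ⊑ q′ √ e → (p + p′) √ d ⊑ (q + q′) √ e
    ⊑-+ p q p′ q′ h h′ = subst₂ _≤_ (sym (square-of-sum p p′ d)) (sym (square-of-sum q q′ e))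
      (+-mono-≤ (+-mono-≤ h h′) (*-monoʳ-≤ 2 (cross-term p q p′ q′ h h′)))

    ⊏-+ : ∀ p q p′ q′ → p √ d ⊏ q √ e → p′ √ d ⊑ q′ √ e → (p + p′) √ d ⊏ (q + q′) √ e
    ⊏-+ p q p′ q′ h h′ = subst₂ _<_ (sym (square-of-sum p p′ d)) (sym (square-of-sum q q′ e))
      (+-mono-<-≤ (+-mono-<-≤ h h′) (*-monoʳ-≤ 2 (cross-term p q p′ q′ (<⇒≤ h) h′)))

  -- Sums and products indexed by subsets.

  ∑ˢ : ∀ k → (Subset k → ℕ) → ℕ
  ∑ˢ zero    f = f []
  ∑ˢ (suc k) f = ∑ˢ k (f ∘ (inside ∷_)) + ∑ˢ k (f ∘ (outside ∷_))

  ∑ˢ-⊑ : ∀ k {d e} (p q : Subset k → ℕ) → (∀ T → p T √ d ⊑ q T √ e) → ∑ˢ k p √ d ⊑ ∑ˢ k q √ e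
  ∑ˢ-⊑ zero    p q h = h []
  ∑ˢ-⊑ (suc k) p q h = ⊑-+ (∑ˢ k (p ∘ (inside ∷_))) (∑ˢ k (q ∘ (inside ∷_))) _ _
    (∑ˢ-⊑ k _ _ (h ∘ (inside ∷_))) (∑ˢ-⊑ k _ _ (h ∘ (outside ∷_)))

  ∑ˢ-cong : ∀ k {f g : Subset k → ℕ} → (∀ T → f T ≡ g T) → ∑ˢ k f ≡ ∑ˢ k g
  ∑ˢ-cong zero    h = h []
  ∑ˢ-cong (suc k) h = cong₂ _+_ (∑ˢ-cong k (h ∘ (inside ∷_))) (∑ˢ-cong k (h ∘ (outside ∷_)))

  private
    interchange : ∀ a b c d → (a + b) + (c + d) ≡ (a + c) + (b + d)
    interchange = solve-∀

  ∑ˢ-distrib-+ : ∀ k (f g : Subset k → ℕ) → ∑ˢ k (λ T → f T + g T) ≡ ∑ˢ k f + ∑ˢ k g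
  ∑ˢ-distrib-+ zero    f g = refl
  ∑ˢ-distrib-+ (suc k) f g = trans
    (cong₂ _+_ (∑ˢ-distrib-+ k (f ∘ (inside ∷_)) (g ∘ (inside ∷_))) (∑ˢ-distrib-+ k (f ∘ (outside ∷_)) (g ∘ (outside ∷_))))
    (interchange (∑ˢ k (f ∘ (inside ∷_))) _ _ _)

  *-distribˡ-∑ˢ : ∀ k c (f : Subset k → ℕ) → ∑ˢ k (λ T → c * f T) ≡ c * ∑ˢ k f
  *-distribˡ-∑ˢ zero    c f = refl
  *-distribˡ-∑ˢ (suc k) c f = trans
    (cong₂ _+_ (*-distribˡ-∑ˢ k c (f ∘ (inside ∷_))) (*-distribˡ-∑ˢ k c (f ∘ (outside ∷_))))
    (sym (*-distribˡ-+ c (∑ˢ k (f ∘ (inside ∷_))) _))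

  ∑ˢ-const : ∀ k c → ∑ˢ k (λ _ → c) ≡ 2 ^ k * c
  ∑ˢ-const zero    c = sym (*-identityˡ c)
  ∑ˢ-const (suc k) c = trans (cong₂ _+_ (∑ˢ-const k c) (∑ˢ-const k c)) (double (2 ^ k) c)
    where
    double : ∀ x y → x * y + x * y ≡ 2 * x * y
    double = solve-∀

  toggle : ∀ {k} → Fin k → Subset k → Subset k
  toggle i T = updateAt T i not

  -- Toggling `i` permutes the subsets: it exchanges those that contain `i` with those that do not.
  ∑ˢ-toggle : ∀ k (i : Fin k) (f : Subset k → ℕ) → ∑ˢ k (f ∘ toggle i) ≡ ∑ˢ k f
  ∑ˢ-toggle (suc k) zero    f = +-comm (∑ˢ k (f ∘ (outside ∷_))) _
  ∑ˢ-toggle (suc k) (suc i) f = cong₂ _+_ (∑ˢ-toggle k i (f ∘ (inside ∷_))) (∑ˢ-toggle k i (f ∘ (outside ∷_)))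

  ∏ˢ : ∀ {k} → (Fin k → ℕ) → Subset k → ℕ
  ∏ˢ d []            = 1
  ∏ˢ d (inside ∷ T)  = d zero * ∏ˢ (d ∘ suc) T
  ∏ˢ d (outside ∷ T) = ∏ˢ (d ∘ suc) T

  ∏ˢ-positive : ∀ {k} (d : Fin k → ℕ) → (∀ i → 0 < d i) → ∀ T → 0 < ∏ˢ d T
  ∏ˢ-positive d d>0 []            = s≤s z≤n
  ∏ˢ-positive d d>0 (inside ∷ T)  = *-mono-≤ (d>0 zero) (∏ˢ-positive (d ∘ suc) (d>0 ∘ suc) T)
  ∏ˢ-positive d d>0 (outside ∷ T) = ∏ˢ-positive (d ∘ suc) (d>0 ∘ suc) T

  -- The witness `g` is the product over T without i, which both factors share; exactly one of them
  -- has the further factor `d i`. This makes u_T u_{T Δ {i}} an integer multiple of √dᵢ.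
  ∏ˢ-toggle : ∀ {k} (d : Fin k → ℕ) i T → ∃[ g ] ∏ˢ d T * ∏ˢ d (toggle i T) ≡ g * g * d i
  ∏ˢ-toggle d zero (inside ∷ T) = ∏ˢ (d ∘ suc) T , rearrange (d zero) (∏ˢ (d ∘ suc) T)
    where
    rearrange : ∀ x y → x * y * y ≡ y * y * x
    rearrange = solve-∀
  ∏ˢ-toggle d zero (outside ∷ T) = ∏ˢ (d ∘ suc) T , rearrange (d zero) (∏ˢ (d ∘ suc) T)
    where
    rearrange : ∀ x y → y * (x * y) ≡ y * y * x
    rearrange = solve-∀
  ∏ˢ-toggle d (suc i) (inside ∷ T) =
    let g , eq = ∏ˢ-toggle (d ∘ suc) i T
    in d zero * g , trans (regroup (d zero) (∏ˢ (d ∘ suc) T) _)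
         (trans (cong (d zero * d zero *_) eq) (ungroup (d zero) g _))
    where
    regroup : ∀ x y z → x * y * (x * z) ≡ x * x * (y * z)
    regroup = solve-∀
    ungroup : ∀ x y z → x * x * (y * y * z) ≡ x * y * (x * y) * z
    ungroup = solve-∀
  ∏ˢ-toggle d (suc i) (outside ∷ T) = ∏ˢ-toggle (d ∘ suc) i T

  ∃-upper-bound : ∀ k (f : Subset k → ℕ) → ∃[ b ] (∀ T → f T ≤ b)
  ∃-upper-bound zero    f = f [] , λ { [] → ≤-refl }
  ∃-upper-bound (suc k) f =
    let b , f≤b = ∃-upper-bound k (f ∘ (inside ∷_))
        c , f≤c = ∃-upper-bound k (f ∘ (outside ∷_))
    in b + c , λ { (inside ∷ T)  → ≤-trans (f≤b T) (m≤m+n b c)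
                 ; (outside ∷ T) → ≤-trans (f≤c T) (m≤n+m c b) }

  -- Simultaneous approximation by the pigeonhole principle.

  #codes : ℕ → ℕ → ℕ
  #codes q zero    = q
  #codes q (suc k) = #codes q k * #codes q k

  -- Whole families of residues are numbered below q^(2^k), so that the pigeonhole principle for
  -- `Fin` applies to them.
  encode : ∀ {q} k → (Subset k → Fin q) → Fin (#codes q k)
  encode zero    f = f []
  encode (suc k) f = combine (encode k (f ∘ (inside ∷_))) (encode k (f ∘ (outside ∷_)))

  encode-injective : ∀ {q} k (f g : Subset k → Fin q) → encode k f ≡ encode k g → ∀ T → f T ≡ g T
  encode-injective zero    f g eq [] = eq
  encode-injective (suc k) f g eq T
    with eqᵢ , eqₒ ← Fin.combine-injective (encode k (f ∘ (inside ∷_))) (encode k (f ∘ (outside ∷_)))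
                       (encode k (g ∘ (inside ∷_))) (encode k (g ∘ (outside ∷_))) eq
    with T
  ... | inside ∷ T  = encode-injective k (f ∘ (inside ∷_)) (g ∘ (inside ∷_)) eqᵢ T
  ... | outside ∷ T = encode-injective k (f ∘ (outside ∷_)) (g ∘ (outside ∷_)) eqₒ T

  -- t is the integer part of √(z / d).
  ∃-floor : ∀ d → 0 < d → ∀ z → ∃[ t ] (t * t * d ≤ z × z < suc t * suc t * d)
  ∃-floor d d>0 zero = 0 , z≤n , *-mono-≤ (s≤s (z≤n {0})) d>0
  ∃-floor d d>0 (suc z) with t , lo , hi ← ∃-floor d d>0 z | suc t * suc t * d ≤? suc z
  ... | no  gt = t , m≤n⇒m≤1+n lo , ≰⇒> gt
  ... | yes le = suc t , le , ≤-<-trans hi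
    (*-monoˡ-< d {{>-nonZero d>0}} (*-mono-< (n<1+n (suc t)) (n<1+n (suc t))))

  congruent-≤ : ∀ q {{_ : NonZero q}} a b → a ≤ b → a mod q ≡ b mod q → ∃[ m ] b ≡ q * m + a
  congruent-≤ q a b a≤b eq = b / q ∸ a / q , (begin-equality
    b                                        ≡⟨ m≡m%n+[m/n]*n b q ⟩
    b % q + b / q * q                        ≡⟨ cong₂ (λ r s → r + s * q) %-eq (m∸n+n≡m (/-monoˡ-≤ q a≤b)) ⟨
    a % q + (b / q ∸ a / q + a / q) * q      ≡⟨ regroup (a % q) (b / q ∸ a / q) (a / q) q ⟩
    q * (b / q ∸ a / q) + (a % q + a / q * q) ≡⟨ cong (q * (b / q ∸ a / q) +_) (m≡m%n+[m/n]*n a q) ⟨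
    q * (b / q ∸ a / q) + a                  ∎)
    where
    open ≤-Reasoning
    %-eq : a % q ≡ b % q
    %-eq = trans (sym (Fin.toℕ-fromℕ< _)) (trans (cong toℕ eq) (Fin.toℕ-fromℕ< _))
    regroup : ∀ r s t q → r + (s + t) * q ≡ q * s + (r + t * q)
    regroup = solve-∀

  module _ {k} (d : Subset k → ℕ) (d>0 : ∀ T → 0 < d T) (q : ℕ) {{_ : NonZero q}} where

    private
      -- The integer part of x q / √(d T). Its residue mod q tells in which of q equal subintervals
      -- of [0, 1) the fractional part of x / √(d T) lies: these are Dirichlet's boxes.
      t : ℕ → Subset k → ℕ
      t x T = proj₁ (∃-floor (d T) (d>0 T) (x * q * (x * q) * 1))

      lower : ∀ x T → t x T √ d T ⊑ (x * q) √ 1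
      lower x T = proj₁ (proj₂ (∃-floor (d T) (d>0 T) (x * q * (x * q) * 1)))

      upper : ∀ x T → (x * q) √ 1 ⊏ suc (t x T) √ d T
      upper x T = proj₂ (proj₂ (∃-floor (d T) (d>0 T) (x * q * (x * q) * 1)))

      t-mono : ∀ {x y} T → x ≤ y → t x T ≤ t y T
      t-mono {x} {y} T x≤y with t x T ≤? t y T
      ... | yes le = le
      ... | no  gt = contradiction (begin-strict
        y * q * (y * q) * 1                 <⟨ upper y T ⟩
        suc (t y T) * suc (t y T) * d T     ≤⟨ *-monoˡ-≤ (d T) (*-mono-≤ (≰⇒> gt) (≰⇒> gt)) ⟩
        t x T * t x T * d T                 ≤⟨ lower x T ⟩
        x * q * (x * q) * 1                 ≤⟨ *-monoˡ-≤ 1 (*-mono-≤ (*-monoˡ-≤ q x≤y) (*-monoˡ-≤ q x≤y)) ⟩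
        y * q * (y * q) * 1                 ∎) (n≮n _)
        where open ≤-Reasoning

      -- If n q exceeded (j + 1) √(d T), adding x q, which is at least `t x T` times √(d T), would
      -- push (n + x) q past `upper (n + x) T`. In the mirror image `above`, rounding costs one unit
      -- in the other direction, hence `pred`; at j = 0 the claim is trivial.
      below : ∀ x n T j → t (n + x) T ≡ j + t x T → (n * q) √ 1 ⊑ suc j √ d T
      below x n T j eq = ≮⇒≥ λ gt → <-asym (upper (n + x) T)
        (subst₂ (λ a b → a √ d T ⊏ b √ 1) (cong suc (sym eq)) (sym (*-distribʳ-+ q n x))
          (⊏-+ (suc j) (n * q) (t x T) (x * q) gt (lower x T)))

      above : ∀ x n T j → t (n + x) T ≡ j + t x T → pred j √ d T ⊑ (n * q) √ 1
      above x n T zero    _  = z≤n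
      above x n T (suc j) eq = ≮⇒≥ λ gt → ≤⇒≯ (lower (n + x) T)
        (subst₂ (λ a b → a √ 1 ⊏ b √ d T) (sym (*-distribʳ-+ q n x)) (trans (+-suc j (t x T)) (sym eq))
          (⊏-+ (n * q) j (x * q) (suc (t x T)) gt (<⇒≤ (upper x T))))

    -- With one more x than there are codes, two of them have equal residues for all T at once.
    -- Their integer parts differ by q m and their multiples of q by n q. After division by q, the
    -- number m √(d T) differs from n by at most √(d T) / q.
    simultaneous-approximation : ∃[ n ] (0 < n ×
      (∀ T → ∃[ m ] ((n * q) √ 1 ⊑ suc (q * m) √ d T × pred (q * m) √ d T ⊑ (n * q) √ 1)))
    simultaneous-approximation
      with i , j , i<j , eq ← Fin.pigeonhole (n<1+n (#codes q k)) (λ x → encode k (λ T → t (toℕ x) T mod q))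
      = toℕ j ∸ toℕ i , m<n⇒0<n∸m i<j , λ T →
        let m , step = congruent-≤ q (t (toℕ i) T) (t (toℕ j) T) (t-mono T (<⇒≤ i<j))
                         (encode-injective k _ _ eq T)
            step′    = trans (cong (λ y → t y T) (m∸n+n≡m (<⇒≤ i<j))) step
        in m , below (toℕ i) (toℕ j ∸ toℕ i) T (q * m) step′ , above (toℕ i) (toℕ j ∸ toℕ i) T (q * m) step′

  -- From close multiples of roots to close squares.

  module _ {K P n d m : ℕ} (K>0 : 0 < K) (n>0 : 0 < n) (d>0 : 0 < d) (d≤P : d ≤ P) where

    private
      -- Squaring n q ≤ (q m + 1) √d leaves the error 2 q m d + d, at most 3 q n P since m ≤ n and d
      -- ≤ P. Divided by q² it becomes 3 n P / q, and this choice of q makes it n / 2K.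
      q = 6 * K * P

      P>0 : 0 < P
      P>0 = ≤-trans d>0 d≤P

      6≤q : 6 ≤ q
      6≤q = *-mono-≤ (*-monoʳ-≤ 6 K>0) P>0

      instance
        q≢0 : NonZero q
        q≢0 = >-nonZero (≤-trans (s≤s z≤n) 6≤q)

      open ≤-Reasoning

      -- As d is at least 1, the hypothesis yields q m ≤ n q + 1. If m exceeded n, then q m would be
      -- at least n q + q, too large because q ≥ 2.
      numerator-≤ : pred (q * m) √ d ⊑ (n * q) √ 1 → m ≤ n
      numerator-≤ h = ≮⇒≥ λ n<m → n≮n (q * m) (begin-strict
        q * m                ≤⟨ suc-pred-≤ (q * m) ⟩
        suc (pred (q * m))   ≤⟨ s≤s (square-cancel-≤ _ _ pred²≤) ⟩
        suc (n * q)          <⟨ +-monoˡ-≤ (n * q) (≤-trans (s≤s (s≤s z≤n)) 6≤q) ⟩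
        q + n * q            ≤⟨ *-monoˡ-≤ q n<m ⟩
        m * q                ≡⟨ *-comm m q ⟩
        q * m                ∎)
        where
        suc-pred-≤ : ∀ j → j ≤ suc (pred j)
        suc-pred-≤ zero    = z≤n
        suc-pred-≤ (suc j) = ≤-refl
        pred²≤ : pred (q * m) * pred (q * m) ≤ n * q * (n * q)
        pred²≤ = subst₂ _≤_ (*-identityʳ _) (*-identityʳ _) (≤-trans (*-monoʳ-≤ (pred (q * m) * pred (q * m)) d>0) h)

      error-≤ : m ≤ n → 2 * K * (2 * (q * m) * d + d) ≤ q * q * n
      error-≤ m≤n = begin
        2 * K * (2 * (q * m) * d + d)           ≤⟨ *-monoʳ-≤ (2 * K) (+-mono-≤ (*-mono-≤ (*-monoʳ-≤ 2 (*-monoʳ-≤ q m≤n)) d≤P) P≤) ⟩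
        2 * K * (2 * (q * n) * P + q * n * P)   ≡⟨ regroup K (q * n) P ⟩
        q * (q * n)                             ≡⟨ *-assoc q q n ⟨
        q * q * n                               ∎
        where
        P≤ : d ≤ q * n * P
        P≤ = ≤-trans d≤P (≤-trans (≤-reflexive (sym (*-identityˡ P)))
          (*-monoˡ-≤ P (*-mono-≤ (≤-trans (s≤s z≤n) 6≤q) n>0)))
        regroup : ∀ K x P → 2 * K * (2 * x * P + x * P) ≡ 6 * K * P * x
        regroup = solve-∀

      clear-denominators : ∀ a b → q * q * a ≤ q * q * b + (2 * (q * m) * d + d) → m ≤ n →
                           2 * K * a ≤ 2 * K * b + n
      clear-denominators a b h m≤n = *-cancelˡ-≤ (q * q) {{m*n≢0 q q}} (begin
        q * q * (2 * K * a)                                             ≡⟨ swap (q * q) (2 * K) a ⟩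
        2 * K * (q * q * a)                                             ≤⟨ *-monoʳ-≤ (2 * K) h ⟩
        2 * K * (q * q * b + (2 * (q * m) * d + d))                     ≡⟨ *-distribˡ-+ (2 * K) (q * q * b) _ ⟩
        2 * K * (q * q * b) + 2 * K * (2 * (q * m) * d + d)             ≤⟨ +-monoʳ-≤ (2 * K * (q * q * b)) (error-≤ m≤n) ⟩
        2 * K * (q * q * b) + q * q * n                                 ≡⟨ cong (_+ q * q * n) (swap (q * q) (2 * K) b) ⟨
        q * q * (2 * K * b) + q * q * n                                 ≡⟨ *-distribˡ-+ (q * q) (2 * K * b) n ⟨
        q * q * (2 * K * b + n)                                         ∎)
        where
        swap : ∀ x y z → x * (y * z) ≡ y * (x * z)
        swap = solve-∀

    squares-close : (n * q) √ 1 ⊑ suc (q * m) √ d → pred (q * m) √ d ⊑ (n * q) √ 1 →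
                    2 * K * (n * n) ≤ 2 * K * (m * m * d) + n ×
                    2 * K * (m * m * d) ≤ 2 * K * (n * n) + n
    squares-close u l =
        clear-denominators (n * n) (m * m * d) (subst₂ _≤_ (square n q) (expand q m d) u) (numerator-≤ l)
      , clear-denominators (m * m * d) (n * n) (begin
          q * q * (m * m * d)                                           ≡⟨ regroup q m d ⟩
          q * m * (q * m) * d                                           ≤⟨ step (q * m) ⟩
          pred (q * m) * pred (q * m) * d + 2 * (q * m) * d             ≤⟨ +-monoˡ-≤ (2 * (q * m) * d) l ⟩
          n * q * (n * q) * 1 + 2 * (q * m) * d                         ≡⟨ cong (_+ 2 * (q * m) * d) (square n q) ⟩
          q * q * (n * n) + 2 * (q * m) * d                             ≤⟨ +-monoʳ-≤ (q * q * (n * n)) (m≤m+n _ d) ⟩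
          q * q * (n * n) + (2 * (q * m) * d + d)                       ∎) (numerator-≤ l)
      where
      square : ∀ n q → n * q * (n * q) * 1 ≡ q * q * (n * n)
      square = solve-∀
      expand : ∀ q m d → suc (q * m) * suc (q * m) * d ≡ q * q * (m * m * d) + (2 * (q * m) * d + d)
      expand = solve-∀
      regroup : ∀ q m d → q * q * (m * m * d) ≡ q * m * (q * m) * d
      regroup = solve-∀
      step : ∀ j → j * j * d ≤ pred j * pred j * d + 2 * j * d
      step zero    = z≤n
      step (suc j) = ≤-trans (m≤m+n _ d) (≤-reflexive (identity j d))
        where
        identity : ∀ j d → suc j * suc j * d + d ≡ j * j * d + 2 * suc j * d
        identity = solve-∀

  -- Arithmetic and geometric means.

  4*m*n≤[m+n]² : ∀ m n → 4 * (m * n) ≤ (m + n) * (m + n)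
  4*m*n≤[m+n]² m n with ≤-total m n
  ... | inj₁ m≤n with o , refl ← m≤n⇒∃[o]m+o≡n m≤n = ≤-trans (m≤m+n _ (o * o)) (≤-reflexive (identity m o))
    where
    identity : ∀ m o → 4 * (m * (m + o)) + o * o ≡ (m + (m + o)) * (m + (m + o))
    identity = solve-∀
  ... | inj₂ n≤m with o , refl ← m≤n⇒∃[o]m+o≡n n≤m = ≤-trans (m≤m+n _ (o * o)) (≤-reflexive (identity n o))
    where
    identity : ∀ n o → 4 * ((n + o) * n) + o * o ≡ (n + o + n) * (n + o + n)
    identity = solve-∀

  -- The arithmetic mean of x and y exceeds their geometric mean by at most 1 / 2K.
  module _ {K n : ℕ} (K>0 : 0 < K) (n>0 : 0 < n) where

    private
      open ≤-Reasoning

      -- With y = x + o, the square of K (x + y) exceeds 4 K² x y by (K o)², while passing from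
      -- `suc s` to `s` lowers the square by 2 s + 1. Both x and y are within n / 2K of n², so K o ≤
      -- n; and 2 s + 1 is roughly 4 K n², amply more than n².
      ordered : ∀ x o s → 2 * K * (n * n) ≤ 2 * K * x + n → 2 * K * (x + o) ≤ 2 * K * (n * n) + n →
                suc s ≡ K * (x + (x + o)) → s * s ≤ K * K * (4 * (x * (x + o)))
      ordered x o s hx hy eq = +-cancelʳ-≤ (K * o * (K * o)) _ _ (begin
        s * s + K * o * (K * o)                             ≤⟨ +-monoʳ-≤ (s * s) Ko²≤ ⟩
        s * s + suc (2 * s)                                 ≡⟨ square s ⟩
        suc s * suc s                                       ≡⟨ cong₂ _*_ eq eq ⟩
        K * (x + (x + o)) * (K * (x + (x + o)))             ≡⟨ expand K x o ⟩
        K * K * (4 * (x * (x + o))) + K * o * (K * o)       ∎)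
        where
        square : ∀ s → s * s + suc (2 * s) ≡ suc s * suc s
        square = solve-∀
        expand : ∀ K x o → K * (x + (x + o)) * (K * (x + (x + o))) ≡ K * K * (4 * (x * (x + o))) + K * o * (K * o)
        expand = solve-∀
        Ko≤n : K * o ≤ n
        Ko≤n = *-cancelˡ-≤ 2 (+-cancelˡ-≤ (2 * K * x) _ _ (begin
          2 * K * x + 2 * (K * o)    ≡⟨ regroup K x o ⟩
          2 * K * (x + o)            ≤⟨ hy ⟩
          2 * K * (n * n) + n        ≤⟨ +-monoˡ-≤ n hx ⟩
          2 * K * x + n + n          ≡⟨ regroup′ (2 * K * x) n ⟩
          2 * K * x + 2 * n          ∎))
          where
          regroup : ∀ K x o → 2 * K * x + 2 * (K * o) ≡ 2 * K * (x + o)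
          regroup = solve-∀
          regroup′ : ∀ a n → a + n + n ≡ a + 2 * n
          regroup′ = solve-∀
        Ko²≤ : K * o * (K * o) ≤ suc (2 * s)
        -- The added 2 n + 1 avoids subtraction: 2 n is the loss when x is compared with n², and 1
        -- is the step from 2 s + 1 to 2 (s + 1). As n ≥ 1, it is at most 3 n².
        Ko²≤ = +-cancelʳ-≤ (suc (2 * n)) _ _ (begin
          K * o * (K * o) + suc (2 * n)          ≤⟨ +-mono-≤ (*-mono-≤ Ko≤n Ko≤n)
                                                     (+-mono-≤ (*-mono-≤ n>0 n>0) (*-monoʳ-≤ 2 (m≤m*n n n {{>-nonZero n>0}}))) ⟩
          n * n + (n * n + 2 * (n * n))          ≡⟨ regroup (n * n) ⟩
          4 * (1 * (n * n))                      ≤⟨ *-monoʳ-≤ 4 (*-monoˡ-≤ (n * n) K>0) ⟩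
          4 * (K * (n * n))                      ≡⟨ regroup′ K (n * n) ⟩
          2 * (2 * K * (n * n))                  ≤⟨ *-monoʳ-≤ 2 hx ⟩
          2 * (2 * K * x + n)                    ≤⟨ m≤m+n _ (2 * (K * o)) ⟩
          2 * (2 * K * x + n) + 2 * (K * o)      ≡⟨ regroup″ K x n o ⟩
          2 * (K * (x + (x + o))) + 2 * n        ≡⟨ cong (λ r → 2 * r + 2 * n) eq ⟨
          2 * suc s + 2 * n                      ≡⟨ regroup‴ s n ⟩
          suc (2 * s) + suc (2 * n)              ∎)
          where
          regroup : ∀ a → a + (a + 2 * a) ≡ 4 * (1 * a)
          regroup = solve-∀
          regroup′ : ∀ K a → 4 * (K * a) ≡ 2 * (2 * K * a)
          regroup′ = solve-∀
          regroup″ : ∀ K x n o → 2 * (2 * K * x + n) + 2 * (K * o) ≡ 2 * (K * (x + (x + o))) + 2 * n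
          regroup″ = solve-∀
          regroup‴ : ∀ s n → 2 * suc s + 2 * n ≡ suc (2 * s) + suc (2 * n)
          regroup‴ = solve-∀

    mean-deficit : ∀ x y s →
      2 * K * (n * n) ≤ 2 * K * x + n → 2 * K * x ≤ 2 * K * (n * n) + n →
      2 * K * (n * n) ≤ 2 * K * y + n → 2 * K * y ≤ 2 * K * (n * n) + n →
      suc s ≡ K * (x + y) → s * s ≤ K * K * (4 * (x * y))
    mean-deficit x y s x≥ x≤ y≥ y≤ eq with ≤-total x y
    ... | inj₁ x≤y with o , refl ← m≤n⇒∃[o]m+o≡n x≤y = ordered x o s x≥ y≤ eq
    ... | inj₂ y≤x with o , refl ← m≤n⇒∃[o]m+o≡n y≤x = subst (s * s ≤_)
      (cong (λ z → K * K * (4 * z)) (*-comm y (y + o)))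
      (ordered y o s y≥ x≤ (trans eq (cong (K *_) (+-comm (y + o) y))))


  -- Summing the means over all subsets.

  -- Put M T = m T² ∏ˢ d T. All M T are close to n², and M T M (toggle i T) = (c T)² d i
  -- for an integer c T, so A = ∑ M T and B = ∑ c T satisfy A − ½ ≤ B √(d i) ≤ A.
  module _ {k} (d : Fin k → ℕ) (nonsquare : ∀ i a b → b * b * d i ≡ a * a → a ≡ 0)
    {n} (n>0 : 0 < n) (m : Subset k → ℕ)
    (close : ∀ T → 2 * 2 ^ k * (n * n) ≤ 2 * 2 ^ k * (m T * m T * ∏ˢ d T) + n ×
                   2 * 2 ^ k * (m T * m T * ∏ˢ d T) ≤ 2 * 2 ^ k * (n * n) + n)
    where

    private
      open ≤-Reasoning

      K = 2 ^ k
      D = ∏ˢ d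

      K>0 : 0 < K
      K>0 = m^n>0 2 k

      M : Subset k → ℕ
      M T = m T * m T * D T

      -- If `M T` were 0, `close` would give 2 K n² ≤ n. Positivity makes `pred A` and
      -- `pred (K * S T)` genuine subtractions of 1.
      M>0 : ∀ T → 0 < M T
      M>0 T with M T | proj₁ (close T)
      ... | suc _ | _ = s≤s z≤n
      ... | zero  | h = contradiction h (<⇒≱ (begin-strict
        2 * K * 0 + n         ≡⟨ cong (_+ n) (*-zeroʳ (2 * K)) ⟩
        n                     <⟨ m<m+n n n>0 ⟩
        n + n                 ≡⟨ double n ⟩
        2 * 1 * (1 * n)       ≤⟨ *-mono-≤ (*-monoʳ-≤ 2 K>0) (*-monoˡ-≤ n n>0) ⟩
        2 * K * (n * n)       ∎))
        where
        double : ∀ n → n + n ≡ 2 * 1 * (1 * n)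
        double = solve-∀

      A : ℕ
      A = ∑ˢ k M

      A-suc : A ≡ suc (pred A)
      A-suc = sym (suc-pred A {{>-nonZero A>0}})
        where
        A>0 : 0 < A
        A>0 = ∑ˢ-positive k M M>0
          where
          ∑ˢ-positive : ∀ k (f : Subset k → ℕ) → (∀ T → 0 < f T) → 0 < ∑ˢ k f
          ∑ˢ-positive zero    f f>0 = f>0 []
          ∑ˢ-positive (suc k) f f>0 = ≤-trans (∑ˢ-positive k _ (f>0 ∘ (inside ∷_))) (m≤m+n _ _)

      module _ (i : Fin k) where

        c : Subset k → ℕ
        c T = m T * m (toggle i T) * proj₁ (∏ˢ-toggle d i T)

        c² : ∀ T → c T * c T * d i ≡ M T * M (toggle i T)
        c² T = begin-equality
          c T * c T * d i                       ≡⟨ regroup (m T * m (toggle i T)) g (d i) ⟩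
          mm * mm * (g * g * d i)               ≡⟨ cong (mm * mm *_) (proj₂ (∏ˢ-toggle d i T)) ⟨
          mm * mm * (D T * D (toggle i T))      ≡⟨ regroup′ (m T) (m (toggle i T)) (D T) (D (toggle i T)) ⟩
          M T * M (toggle i T)                  ∎
          where
          g = proj₁ (∏ˢ-toggle d i T)
          mm = m T * m (toggle i T)
          regroup : ∀ x g d → x * g * (x * g) * d ≡ x * x * (g * g * d)
          regroup = solve-∀
          regroup′ : ∀ x y d e → x * y * (x * y) * (d * e) ≡ x * x * d * (y * y * e)
          regroup′ = solve-∀

        -- The factor 2 keeps the arithmetic means free of halves. The factor `j` is 1 for the upper
        -- estimate and K for the lower one, whose denominator K is cleared.
        4c² : ∀ j T → j * (2 * c T) * (j * (2 * c T)) * d i ≡ j * j * (4 * (M T * M (toggle i T)))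
        4c² j T = trans (regroup j (c T) (d i)) (cong (λ z → j * j * (4 * z)) (c² T))
          where
          regroup : ∀ j c d → j * (2 * c) * (j * (2 * c)) * d ≡ j * j * (4 * (c * c * d))
          regroup = solve-∀

        B : ℕ
        B = ∑ˢ k c

        S : Subset k → ℕ
        S T = M T + M (toggle i T)

        ∑S : ∑ˢ k S ≡ 2 * A
        ∑S = trans (∑ˢ-distrib-+ k M (M ∘ toggle i)) (cong (A +_) (trans (∑ˢ-toggle k i M) (sym (+-identityʳ A))))

        mean-≤ : ∀ T → (1 * (2 * c T)) √ d i ⊑ S T √ 1
        mean-≤ T = begin
          1 * (2 * c T) * (1 * (2 * c T)) * d i       ≡⟨ 4c² 1 T ⟩
          1 * 1 * (4 * (M T * M (toggle i T)))        ≡⟨ *-identityˡ _ ⟩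
          4 * (M T * M (toggle i T))                  ≤⟨ 4*m*n≤[m+n]² (M T) _ ⟩
          S T * S T                                   ≡⟨ *-identityʳ _ ⟨
          S T * S T * 1                               ∎

        KS-suc : ∀ T → suc (pred (K * S T)) ≡ K * S T
        KS-suc T = suc-pred (K * S T) {{>-nonZero (*-mono-≤ K>0 (≤-trans (M>0 T) (m≤m+n _ _)))}}

        mean-≥ : ∀ T → pred (K * S T) √ 1 ⊑ (K * (2 * c T)) √ d i
        mean-≥ T = begin
          pred (K * S T) * pred (K * S T) * 1         ≡⟨ *-identityʳ _ ⟩
          pred (K * S T) * pred (K * S T)             ≤⟨ mean-deficit K>0 n>0 (M T) (M (toggle i T)) _
                                                           (proj₁ (close T)) (proj₂ (close T))
                                                           (proj₁ (close (toggle i T))) (proj₂ (close (toggle i T)))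
                                                           (KS-suc T) ⟩
          K * K * (4 * (M T * M (toggle i T)))        ≡⟨ 4c² K T ⟨
          K * (2 * c T) * (K * (2 * c T)) * d i       ∎

        ∑2c : ∀ j → ∑ˢ k (λ T → j * (2 * c T)) ≡ j * (2 * B)
        ∑2c j = trans (*-distribˡ-∑ˢ k j (λ T → 2 * c T)) (cong (j *_) (*-distribˡ-∑ˢ k 2 c))

        ∑predKS : ∑ˢ k (λ T → pred (K * S T)) ≡ K * suc (2 * pred A)
        -- Each of the 2^k terms loses 1 to `pred`, altogether K. Against the total 2 K A this
        -- amounts to a loss of ½ in A.
        ∑predKS = +-cancelʳ-≡ (K * 1) _ _ (begin-equality
          ∑ˢ k (λ T → pred (K * S T)) + K * 1               ≡⟨ cong (∑ˢ k (λ T → pred (K * S T)) +_) (∑ˢ-const k 1) ⟨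
          ∑ˢ k (λ T → pred (K * S T)) + ∑ˢ k (λ _ → 1)      ≡⟨ ∑ˢ-distrib-+ k (λ T → pred (K * S T)) (λ _ → 1) ⟨
          ∑ˢ k (λ T → pred (K * S T) + 1)                   ≡⟨ ∑ˢ-cong k (λ T → trans (+-comm _ 1) (KS-suc T)) ⟩
          ∑ˢ k (λ T → K * S T)                              ≡⟨ *-distribˡ-∑ˢ k K S ⟩
          K * ∑ˢ k S                                        ≡⟨ cong (K *_) ∑S ⟩
          K * (2 * A)                                       ≡⟨ cong (λ a → K * (2 * a)) A-suc ⟩
          K * (2 * suc (pred A))                            ≡⟨ regroup K (pred A) ⟩
          K * suc (2 * pred A) + K * 1                      ∎)
          where
          regroup : ∀ K a → K * (2 * suc a) ≡ K * suc (2 * a) + K * 1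
          regroup = solve-∀

        lower-bound : pred A * pred A < B * B * d i
        -- If B √(d i) were at most A - 1, the summed estimate would read K (2 A - 1) ≤ K (2 A - 2).
        lower-bound = ≰⇒> λ B²d≤ → n≮n _ (begin-strict
          K * suc a * (K * suc a) * 1              ≤⟨ subst₂ (λ p q → p √ 1 ⊑ q √ d i) ∑predKS (∑2c K)
                                                        (∑ˢ-⊑ k _ (λ T → K * (2 * c T)) mean-≥) ⟩
          K * (2 * B) * (K * (2 * B)) * d i        ≡⟨ regroup K B (d i) ⟩
          K * K * (4 * (B * B * d i))              ≤⟨ *-monoʳ-≤ (K * K) (*-monoʳ-≤ 4 B²d≤) ⟩
          K * K * (4 * (pred A * pred A))          ≡⟨ regroup′ K (pred A) ⟩
          K * a * (K * a) * 1                      <⟨ *-monoˡ-< 1 (*-mono-< K*a< K*a<) ⟩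
          K * suc a * (K * suc a) * 1              ∎)
          where
          a = 2 * pred A
          K*a< : K * a < K * suc a
          K*a< = *-monoʳ-< K {{>-nonZero K>0}} (n<1+n a)
          regroup : ∀ K B d → K * (2 * B) * (K * (2 * B)) * d ≡ K * K * (4 * (B * B * d))
          regroup = solve-∀
          regroup′ : ∀ K n → K * K * (4 * (n * n)) ≡ K * (2 * n) * (K * (2 * n)) * 1
          regroup′ = solve-∀

        B²d≤A² : B * B * d i ≤ A * A
        B²d≤A² = *-cancelˡ-≤ 4 (begin
          4 * (B * B * d i)                        ≡⟨ regroup B (d i) ⟩
          1 * (2 * B) * (1 * (2 * B)) * d i        ≤⟨ subst₂ (λ p q → p √ d i ⊑ q √ 1) (∑2c 1) ∑S
                                                        (∑ˢ-⊑ k (λ T → 1 * (2 * c T)) S mean-≤) ⟩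
          2 * A * (2 * A) * 1                      ≡⟨ regroup′ A ⟩
          4 * (A * A)                              ∎)
          where
          regroup : ∀ B d → 4 * (B * B * d) ≡ 1 * (2 * B) * (1 * (2 * B)) * d
          regroup = solve-∀
          regroup′ : ∀ A → 2 * A * (2 * A) * 1 ≡ 4 * (A * A)
          regroup′ = solve-∀

        upper-bound : B * B * d i < suc (pred A) * suc (pred A)
        upper-bound = subst (λ x → B * B * d i < x * x) A-suc
          -- In case of equality `nonsquare` would force the positive number A to vanish.
          (≤∧≢⇒< B²d≤A² λ eq → contradiction (trans (sym A-suc) (nonsquare i A B eq)) λ ())

    square-gap : ∃[ a ] (∀ i → ∃[ b ] (a * a < b * b * d i × b * b * d i < suc a * suc a))
    square-gap = pred A , λ i → B i , lower-bound i , upper-bound i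

  simultaneous-square-gap : ∀ {k} (d : Fin k → ℕ) → (∀ i → 0 < d i) →
    (∀ i a b → b * b * d i ≡ a * a → a ≡ 0) →
    ∃[ n ] (∀ i → ∃[ b ] (n * n < b * b * d i × b * b * d i < suc n * suc n))
  simultaneous-square-gap {k} d d>0 nonsquare = square-gap d nonsquare n>0 m close
    where
    K = 2 ^ k
    D = ∏ˢ d
    D>0 = ∏ˢ-positive d d>0
    P = proj₁ (∃-upper-bound k D)
    D≤P = proj₂ (∃-upper-bound k D)

    K>0 : 0 < K
    K>0 = m^n>0 2 k

    q = 6 * K * P

    q>0 : 0 < q
    -- P is positive because it bounds the positive product over some subset; the full one is chosen
    -- arbitrarily.
    q>0 = *-mono-≤ (*-mono-≤ (s≤s (z≤n {5})) K>0) (≤-trans (D>0 (replicate k inside)) (D≤P (replicate k inside)))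

    approximation = simultaneous-approximation D D>0 q {{>-nonZero q>0}}
    n = proj₁ approximation
    n>0 = proj₁ (proj₂ approximation)

    m : Subset k → ℕ
    m T = proj₁ (proj₂ (proj₂ approximation) T)

    close : ∀ T → 2 * K * (n * n) ≤ 2 * K * (m T * m T * D T) + n × 2 * K * (m T * m T * D T) ≤ 2 * K * (n * n) + n
    close T = let u , l = proj₂ (proj₂ (proj₂ approximation) T)
              in squares-close K>0 n>0 (D>0 T) (D≤P T) u l

-- Algebra with rational coefficients, for ℝ and ℂ at once.

-- Comparing two terms of ℝ or ℂ that are not literally the same makes Agda unfold the proofs
-- that they are Cauchy sequences. Hence algebra is done here over an abstract carrier, with the
-- operations ⊞, ⊠, ⊟ as parameters so that instances mention those of Defs literally. Later on,
-- implicit arguments of type ℝ or ℂ are given explicitly, and a proof e : x ≈ᴿ y is passed on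
-- as mk≈ᴿ (close e) at types that agree with x ≈ᴿ y only after reduction.
module ℚ-Algebra {c ℓ} {A : Set c} (_≋_ : A → A → Set ℓ) (_⊞_ _⊠_ : A → A → A) (⊟_ : A → A) (0# 1# : A)
  (isCommutativeRing : IsCommutativeRing _≋_ _⊞_ _⊠_ ⊟_ 0# 1#) (⟦_⟧ : ℚ → A)
  (+-homo : ∀ p q → ⟦ p ℚ.+ q ⟧ ≋ (⟦ p ⟧ ⊞ ⟦ q ⟧)) (*-homo : ∀ p q → ⟦ p ℚ.* q ⟧ ≋ (⟦ p ⟧ ⊠ ⟦ q ⟧))
  (-‿homo : ∀ p → ⟦ ℚ.- p ⟧ ≋ (⊟ ⟦ p ⟧)) (0-homo : ⟦ 0ℚ ⟧ ≋ 0#) (1-homo : ⟦ 1ℚ ⟧ ≋ 1#) where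

  private
    R : CommutativeRing c ℓ
    R = record { isCommutativeRing = isCommutativeRing }

  open CommutativeRing R hiding (0#; 1#; isCommutativeRing) renaming (refl to ≈-refl)
  open import Relation.Binary.Reasoning.Setoid setoid

  private
    ⟦⟧-morphism : ℚ.+-*-rawRing ACR.-Raw-AlmostCommutative⟶ ACR.fromCommutativeRing R
    ⟦⟧-morphism = record
      { ⟦_⟧ = ⟦_⟧ ; +-homo = +-homo ; *-homo = *-homo ; -‿homo = -‿homo ; 0-homo = 0-homo ; 1-homo = 1-homo }

    _≟_ : ∀ p q → Maybe (⟦ p ⟧ ≋ ⟦ q ⟧)
    p ≟ q = Maybe.map (λ p≡q → CommutativeRing.reflexive R (cong ⟦_⟧ p≡q)) (dec⇒maybe (p ℚ.≟ q))

  open Algebra.Solver.Ring ℚ.+-*-rawRing (ACR.fromCommutativeRing R) ⟦⟧-morphism _≟_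
    using (solve; _:=_; _:+_; _:*_; :-_; con)

  private
    cancel-inverse : ∀ p u r → u ℚ.* r ≡ 1ℚ → p ℚ.* u ℚ.* r ≡ p
    cancel-inverse p u r ur≡1 = ≡.trans (ℚ.*-assoc p u r) (≡.trans (cong (p ℚ.*_) ur≡1) (ℚ.*-identityʳ p))

  half-zero : ∀ x y → ((x ⊠ y) ⊞ (y ⊠ x)) ≋ 0# → (x ⊠ y) ≋ 0#
  half-zero x y eq = begin
    x * y                        ≈⟨ solve 2 (λ x y → x :* y := con ½ :* (x :* y :+ y :* x)) ≈-refl x y ⟩
    ⟦ ½ ⟧ * (x * y + y * x)      ≈⟨ *-congˡ eq ⟩
    ⟦ ½ ⟧ * 0#                   ≈⟨ zeroʳ ⟦ ½ ⟧ ⟩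
    0#                           ∎

  neg-zero : ∀ x y → (x ⊠ y) ≋ 0# → (x ⊠ (⊟ y)) ≋ 0#
  neg-zero x y eq = begin
    x * - y                      ≈⟨ solve 2 (λ x y → x :* :- y := con (ℚ.- 1ℚ) :* (x :* y)) ≈-refl x y ⟩
    ⟦ ℚ.- 1ℚ ⟧ * (x * y)         ≈⟨ *-congˡ eq ⟩
    ⟦ ℚ.- 1ℚ ⟧ * 0#              ≈⟨ zeroʳ ⟦ ℚ.- 1ℚ ⟧ ⟩
    0#                           ∎

  neg-square : ∀ y → ((⊟ y) ⊠ (⊟ y)) ≋ (y ⊠ y)
  neg-square = solve 1 (λ y → :- y :* :- y := y :* y) ≈-refl

  isolate-square : ∀ x y D → ((x ⊠ x) ⊞ (⊟ (y ⊠ y))) ≋ ⟦ D ⟧ → (y ⊠ y) ≋ (⟦ ℚ.- D ⟧ ⊞ (x ⊠ x))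
  isolate-square x y D eq = begin
    y * y                              ≈⟨ solve 2 (λ x y → y :* y := :- (x :* x :+ :- (y :* y)) :+ x :* x) ≈-refl x y ⟩
    - (x * x + - (y * y)) + x * x      ≈⟨ +-congʳ (-‿cong eq) ⟩
    - ⟦ D ⟧ + x * x                    ≈⟨ +-congʳ (-‿homo D) ⟨
    ⟦ ℚ.- D ⟧ + x * x                  ∎

  imaginary-square : ∀ x y D → ((x ⊠ x) ⊞ (⊟ (y ⊠ y))) ≋ ⟦ D ⟧ → x ≋ 0# → (y ⊠ y) ≋ ⟦ ℚ.- D ⟧
  imaginary-square x y D eq x≈0 = begin
    y * y                     ≈⟨ isolate-square x y D eq ⟩
    ⟦ ℚ.- D ⟧ + x * x         ≈⟨ +-congˡ (*-congʳ x≈0) ⟩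
    ⟦ ℚ.- D ⟧ + 0# * x        ≈⟨ +-congˡ (zeroˡ x) ⟩
    ⟦ ℚ.- D ⟧ + 0#            ≈⟨ +-identityʳ ⟦ ℚ.- D ⟧ ⟩
    ⟦ ℚ.- D ⟧                 ∎

  difference-of-squares : ∀ t r → (t ⊠ t) ≋ ⟦ r ℚ.* r ⟧ → ((t ⊞ (⊟ ⟦ r ⟧)) ⊠ (t ⊞ ⟦ r ⟧)) ≋ 0#
  difference-of-squares t r eq = begin
    (t + - ⟦ r ⟧) * (t + ⟦ r ⟧)            ≈⟨ solve 2 (λ t r → (t :+ :- r) :* (t :+ r) := t :* t :+ :- (r :* r)) ≈-refl t ⟦ r ⟧ ⟩
    t * t + - (⟦ r ⟧ * ⟦ r ⟧)              ≈⟨ +-congʳ eq ⟩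
    ⟦ r ℚ.* r ⟧ + - (⟦ r ⟧ * ⟦ r ⟧)        ≈⟨ +-congʳ (*-homo r r) ⟩
    ⟦ r ⟧ * ⟦ r ⟧ + - (⟦ r ⟧ * ⟦ r ⟧)      ≈⟨ -‿inverseʳ (⟦ r ⟧ * ⟦ r ⟧) ⟩
    0#                                     ∎

  difference-zero : ∀ t r → (t ⊞ (⊟ r)) ≋ 0# → t ≋ r
  difference-zero t r eq = begin
    t                ≈⟨ solve 2 (λ t r → t := (t :+ :- r) :+ r) ≈-refl t r ⟩
    (t + - r) + r    ≈⟨ +-congʳ eq ⟩
    0# + r           ≈⟨ +-identityˡ r ⟩
    r                ∎

  scaled-square : ∀ s δ n → (s ⊠ s) ≋ ⟦ δ ⟧ → ((⟦ n ⟧ ⊠ s) ⊠ (⟦ n ⟧ ⊠ s)) ≋ ⟦ n ℚ.* n ℚ.* δ ⟧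
  scaled-square s δ n eq = begin
    (⟦ n ⟧ * s) * (⟦ n ⟧ * s)      ≈⟨ solve 2 (λ n s → (n :* s) :* (n :* s) := n :* n :* (s :* s)) ≈-refl ⟦ n ⟧ s ⟩
    ⟦ n ⟧ * ⟦ n ⟧ * (s * s)        ≈⟨ *-congˡ eq ⟩
    ⟦ n ⟧ * ⟦ n ⟧ * ⟦ δ ⟧          ≈⟨ *-congʳ (*-homo n n) ⟨
    ⟦ n ℚ.* n ⟧ * ⟦ δ ⟧            ≈⟨ *-homo (n ℚ.* n) δ ⟨
    ⟦ n ℚ.* n ℚ.* δ ⟧              ∎

  -- Since p = (p u) q, the term p b is completed to p u times the given expression of 1, and the
  -- correction involves only c.
  eliminate : ∀ b c p p′ q q′ u → q ℚ.* u ≡ 1ℚ → 1# ≋ ((⟦ q ⟧ ⊠ b) ⊞ (⟦ q′ ⟧ ⊠ c)) →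
    ((⟦ p ⟧ ⊠ b) ⊞ (⟦ p′ ⟧ ⊠ c)) ≋ (⟦ p ℚ.* u ⟧ ⊞ (⟦ p′ ℚ.+ ℚ.- (p ℚ.* u ℚ.* q′) ⟧ ⊠ c))
  eliminate b c p p′ q q′ u qu≡1 one = begin
    ⟦ p ⟧ * b + ⟦ p′ ⟧ * c
      ≈⟨ +-congʳ (*-congʳ p≈vq) ⟩
    v * ⟦ q ⟧ * b + ⟦ p′ ⟧ * c
      ≈⟨ solve 6 (λ v q b p′ c q′ → v :* q :* b :+ p′ :* c := v :* (q :* b :+ q′ :* c) :+ (p′ :+ :- (v :* q′)) :* c)
           ≈-refl v ⟦ q ⟧ b ⟦ p′ ⟧ c ⟦ q′ ⟧ ⟩
    v * (⟦ q ⟧ * b + ⟦ q′ ⟧ * c) + (⟦ p′ ⟧ + - (v * ⟦ q′ ⟧)) * c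
      ≈⟨ +-cong (*-congˡ (sym one)) (*-congʳ (sym coefficient)) ⟩
    v * 1# + ⟦ p′ ℚ.+ ℚ.- (p ℚ.* u ℚ.* q′) ⟧ * c
      ≈⟨ +-congʳ (*-identityʳ v) ⟩
    v + ⟦ p′ ℚ.+ ℚ.- (p ℚ.* u ℚ.* q′) ⟧ * c ∎
    where
    v = ⟦ p ℚ.* u ⟧
    p≈vq : ⟦ p ⟧ ≈ v * ⟦ q ⟧
    p≈vq = begin
      ⟦ p ⟧                    ≡⟨ cong ⟦_⟧ (cancel-inverse p u q (≡.trans (ℚ.*-comm u q) qu≡1)) ⟨
      ⟦ p ℚ.* u ℚ.* q ⟧        ≈⟨ *-homo (p ℚ.* u) q ⟩
      v * ⟦ q ⟧                ∎
    coefficient : ⟦ p′ ℚ.+ ℚ.- (p ℚ.* u ℚ.* q′) ⟧ ≈ ⟦ p′ ⟧ + - (v * ⟦ q′ ⟧)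
    coefficient = begin
      ⟦ p′ ℚ.+ ℚ.- (p ℚ.* u ℚ.* q′) ⟧      ≈⟨ +-homo p′ _ ⟩
      ⟦ p′ ⟧ + ⟦ ℚ.- (p ℚ.* u ℚ.* q′) ⟧    ≈⟨ +-congˡ (-‿homo (p ℚ.* u ℚ.* q′)) ⟩
      ⟦ p′ ⟧ + - ⟦ p ℚ.* u ℚ.* q′ ⟧        ≈⟨ +-congˡ (-‿cong (*-homo (p ℚ.* u) q′)) ⟩
      ⟦ p′ ⟧ + - (v * ⟦ q′ ⟧)              ∎

  completed-square : ∀ α p r → (α ⊠ α) ≋ (⟦ p ⟧ ⊞ (⟦ r ⟧ ⊠ α)) →
    ((α ⊞ ⟦ ℚ.- ½ ℚ.* r ⟧) ⊠ (α ⊞ ⟦ ℚ.- ½ ℚ.* r ⟧)) ≋ ⟦ p ℚ.+ ½ ℚ.* r ℚ.* (½ ℚ.* r) ⟧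
  completed-square α p r eq = begin
    (α + ⟦ ℚ.- ½ ℚ.* r ⟧) * (α + ⟦ ℚ.- ½ ℚ.* r ⟧)
      ≈⟨ *-cong (+-congˡ (*-homo (ℚ.- ½) r)) (+-congˡ (*-homo (ℚ.- ½) r)) ⟩
    (α + ⟦ ℚ.- ½ ⟧ * ⟦ r ⟧) * (α + ⟦ ℚ.- ½ ⟧ * ⟦ r ⟧)
      ≈⟨ solve 2 (λ α r → (α :+ con (ℚ.- ½) :* r) :* (α :+ con (ℚ.- ½) :* r)
           := α :* α :+ (:- (r :* α) :+ con ½ :* r :* (con ½ :* r))) ≈-refl α ⟦ r ⟧ ⟩
    α * α + (- (⟦ r ⟧ * α) + ⟦ ½ ⟧ * ⟦ r ⟧ * (⟦ ½ ⟧ * ⟦ r ⟧))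
      ≈⟨ +-congʳ eq ⟩
    ⟦ p ⟧ + ⟦ r ⟧ * α + (- (⟦ r ⟧ * α) + ⟦ ½ ⟧ * ⟦ r ⟧ * (⟦ ½ ⟧ * ⟦ r ⟧))
      ≈⟨ solve 3 (λ p x y → p :+ x :+ (:- x :+ y) := p :+ y) ≈-refl ⟦ p ⟧ (⟦ r ⟧ * α) (⟦ ½ ⟧ * ⟦ r ⟧ * (⟦ ½ ⟧ * ⟦ r ⟧)) ⟩
    ⟦ p ⟧ + ⟦ ½ ⟧ * ⟦ r ⟧ * (⟦ ½ ⟧ * ⟦ r ⟧)
      ≈⟨ +-congˡ (*-cong (*-homo ½ r) (*-homo ½ r)) ⟨
    ⟦ p ⟧ + ⟦ ½ ℚ.* r ⟧ * ⟦ ½ ℚ.* r ⟧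
      ≈⟨ +-congˡ (*-homo (½ ℚ.* r) (½ ℚ.* r)) ⟨
    ⟦ p ⟧ + ⟦ ½ ℚ.* r ℚ.* (½ ℚ.* r) ⟧
      ≈⟨ +-homo p _ ⟨
    ⟦ p ℚ.+ ½ ℚ.* r ℚ.* (½ ℚ.* r) ⟧ ∎

  translate : ∀ α z p q s → z ≋ (⟦ p ⟧ ⊞ (⟦ q ⟧ ⊠ α)) → z ≋ (⟦ p ℚ.+ ℚ.- (q ℚ.* s) ⟧ ⊞ (⟦ q ⟧ ⊠ (α ⊞ ⟦ s ⟧)))
  translate α z p q s eq = begin
    z                                                    ≈⟨ eq ⟩
    ⟦ p ⟧ + ⟦ q ⟧ * α                                    ≈⟨ solve 4 (λ p q s α → p :+ q :* α := (p :+ :- (q :* s)) :+ q :* (α :+ s))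
                                                              ≈-refl ⟦ p ⟧ ⟦ q ⟧ ⟦ s ⟧ α ⟩
    (⟦ p ⟧ + - (⟦ q ⟧ * ⟦ s ⟧)) + ⟦ q ⟧ * (α + ⟦ s ⟧)    ≈⟨ +-congʳ (+-congˡ (-‿cong (*-homo q s))) ⟨
    (⟦ p ⟧ + - ⟦ q ℚ.* s ⟧) + ⟦ q ⟧ * (α + ⟦ s ⟧)        ≈⟨ +-congʳ (+-congˡ (-‿homo (q ℚ.* s))) ⟨
    (⟦ p ⟧ + ⟦ ℚ.- (q ℚ.* s) ⟧) + ⟦ q ⟧ * (α + ⟦ s ⟧)    ≈⟨ +-congʳ (+-homo p _) ⟨
    ⟦ p ℚ.+ ℚ.- (q ℚ.* s) ⟧ + ⟦ q ⟧ * (α + ⟦ s ⟧)        ∎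

  rescale-generator : ∀ w w′ z p q r u → u ℚ.* r ≡ 1ℚ → w′ ≋ (⟦ r ⟧ ⊠ w) → z ≋ (⟦ p ⟧ ⊞ (⟦ q ⟧ ⊠ w)) →
    z ≋ (⟦ p ⟧ ⊞ (⟦ q ℚ.* u ⟧ ⊠ w′))
  rescale-generator w w′ z p q r u ur≡1 w′≈ eq = begin
    z                                      ≈⟨ eq ⟩
    ⟦ p ⟧ + ⟦ q ⟧ * w                      ≡⟨ cong (λ t → ⟦ p ⟧ + ⟦ t ⟧ * w) (cancel-inverse q u r ur≡1) ⟨
    ⟦ p ⟧ + ⟦ q ℚ.* u ℚ.* r ⟧ * w          ≈⟨ +-congˡ (*-congʳ (*-homo (q ℚ.* u) r)) ⟩
    ⟦ p ⟧ + ⟦ q ℚ.* u ⟧ * ⟦ r ⟧ * w        ≈⟨ +-congˡ (*-assoc ⟦ q ℚ.* u ⟧ ⟦ r ⟧ w) ⟩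
    ⟦ p ⟧ + ⟦ q ℚ.* u ⟧ * (⟦ r ⟧ * w)      ≈⟨ +-congˡ (*-congˡ w′≈) ⟨
    ⟦ p ⟧ + ⟦ q ℚ.* u ⟧ * w′               ∎

  inverse-unique : ∀ x y z → (x ⊠ y) ≋ 1# → (x ⊠ z) ≋ 1# → y ≋ z
  inverse-unique x y z xy≈1 xz≈1 = begin
    y              ≈⟨ *-identityʳ y ⟨
    y * 1#         ≈⟨ *-congˡ xz≈1 ⟨
    y * (x * z)    ≈⟨ solve 3 (λ x y z → y :* (x :* z) := (x :* y) :* z) ≈-refl x y z ⟩
    (x * y) * z    ≈⟨ *-congʳ xy≈1 ⟩
    1# * z         ≈⟨ *-identityˡ z ⟩
    z              ∎

  divide : ∀ p b a w → p ℚ.* b ≡ a → (⟦ b ⟧ ⊠ w) ≋ 1# → (⟦ a ⟧ ⊠ w) ≋ ⟦ p ⟧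
  divide p b a w pb≡a bw≈1 = begin
    ⟦ a ⟧ * w                ≡⟨ cong (λ t → ⟦ t ⟧ * w) pb≡a ⟨
    ⟦ p ℚ.* b ⟧ * w          ≈⟨ *-congʳ (*-homo p b) ⟩
    ⟦ p ⟧ * ⟦ b ⟧ * w        ≈⟨ *-assoc ⟦ p ⟧ ⟦ b ⟧ w ⟩
    ⟦ p ⟧ * (⟦ b ⟧ * w)      ≈⟨ *-congˡ bw≈1 ⟩
    ⟦ p ⟧ * 1#               ≈⟨ *-identityʳ ⟦ p ⟧ ⟩
    ⟦ p ⟧                    ∎

  scale-by-one : ∀ x y → x ≋ y → y ≋ (⟦ 1ℚ ⟧ ⊠ x)
  scale-by-one x y eq = begin
    y               ≈⟨ eq ⟨
    x               ≈⟨ solve 1 (λ x → x := con 1ℚ :* x) ≈-refl x ⟩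
    ⟦ 1ℚ ⟧ * x      ∎

  scale-by-minus-one : ∀ x y → (⊟ x) ≋ y → y ≋ (⟦ ℚ.- 1ℚ ⟧ ⊠ x)
  scale-by-minus-one x y eq = begin
    y                    ≈⟨ eq ⟨
    - x                  ≈⟨ solve 1 (λ x → :- x := con (ℚ.- 1ℚ) :* x) ≈-refl x ⟩
    ⟦ ℚ.- 1ℚ ⟧ * x       ∎

  zero-combination : ∀ x y → ((⟦ 0ℚ ⟧ ⊠ x) ⊞ (⟦ 0ℚ ⟧ ⊠ y)) ≋ 0#
  zero-combination x y = begin
    ⟦ 0ℚ ⟧ * x + ⟦ 0ℚ ⟧ * y     ≈⟨ solve 2 (λ x y → con 0ℚ :* x :+ con 0ℚ :* y := con 0ℚ) ≈-refl x y ⟩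
    ⟦ 0ℚ ⟧                      ≈⟨ 0-homo ⟩
    0#                          ∎

  cancel-scale : ∀ u r x → u ℚ.* r ≡ 1ℚ → (⟦ u ⟧ ⊠ (⟦ r ⟧ ⊠ x)) ≋ x
  cancel-scale u r x ur≡1 = begin
    ⟦ u ⟧ * (⟦ r ⟧ * x)     ≈⟨ *-assoc ⟦ u ⟧ ⟦ r ⟧ x ⟨
    ⟦ u ⟧ * ⟦ r ⟧ * x       ≈⟨ *-congʳ (*-homo u r) ⟨
    ⟦ u ℚ.* r ⟧ * x         ≡⟨ cong (λ q → ⟦ q ⟧ * x) ur≡1 ⟩
    ⟦ 1ℚ ⟧ * x              ≈⟨ solve 1 (λ x → con 1ℚ :* x := x) ≈-refl x ⟩
    x                       ∎

  zero-not-invertible : ∀ x y → x ≋ 0# → (x ⊠ y) ≋ 1# → 1# ≋ 0#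
  zero-not-invertible x y x≈0 xy≈1 = begin
    1#        ≈⟨ xy≈1 ⟨
    x * y     ≈⟨ *-congʳ x≈0 ⟩
    0# * y    ≈⟨ zeroˡ y ⟩
    0#        ∎

  affine-zero : ∀ q x y → y ≋ 0# → (0# ⊞ ((q ⊠ y) ⊞ (0# ⊠ x))) ≋ 0#
  affine-zero q x y y≈0 = begin
    0# + (q * y + 0# * x)     ≈⟨ +-identityˡ _ ⟩
    q * y + 0# * x            ≈⟨ +-cong (trans (*-congˡ y≈0) (zeroʳ q)) (zeroˡ x) ⟩
    0# + 0#                   ≈⟨ +-identityˡ 0# ⟩
    0#                        ∎

open import Defs

-- ℝ and ℂ as commutative rings.

module ComplexNumbers where

  open import Data.Rational.Base using (_+_; _*_; _-_; -_; ∣_∣; _<_; _≤_)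
  open ≡ using (refl; sym; trans; cong₂; subst; subst₂)
  open CauchyLemmas
  open _≈ᴿ_
  open _≈_

  pointwise : ∀ {x y} → (∀ n → seq x n ≡ seq y n) → x ≈ᴿ y
  pointwise {x} {y} x≡y = mk≈ᴿ λ ε 0<ε → 0 , λ n _ →
    subst (_< ε) (sym (cong ∣_∣ (trans (cong (_- seq y n) (x≡y n)) (ℚ.+-inverseʳ (seq y n))))) 0<ε

  module _ where
    open +-*-Solver

    diff-flip : ∀ a b → - (a - b) ≡ b - a
    diff-flip = solve 2 (λ a b → :- (a :- b) := b :- a) refl

    diff-trans : ∀ a b c → a - c ≡ (a - b) + (b - c)
    diff-trans = solve 3 (λ a b c → a :- c := (a :- b) :+ (b :- c)) refl

  ≈ᴿ-refl : ∀ {x} → x ≈ᴿ x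
  ≈ᴿ-refl {x} = pointwise {x} {x} (λ _ → refl)

  ≈ᴿ-sym : ∀ {x y} → x ≈ᴿ y → y ≈ᴿ x
  ≈ᴿ-sym {x} {y} x≈y = mk≈ᴿ λ ε 0<ε → let N , h = close x≈y ε 0<ε in N , λ n N≤n →
    subst (_< ε) (trans (sym (ℚ.∣-p∣≡∣p∣ (seq x n - seq y n))) (cong ∣_∣ (diff-flip (seq x n) (seq y n)))) (h n N≤n)

  ≈ᴿ-trans : ∀ {x y z} → x ≈ᴿ y → y ≈ᴿ z → x ≈ᴿ z
  ≈ᴿ-trans {x} {y} {z} x≈y y≈z = mk≈ᴿ λ ε 0<ε →
    let M , h = close x≈y (½ * ε) (half-pos 0<ε)
        N , k = close y≈z (½ * ε) (half-pos 0<ε)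
    in M ℕ.⊔ N , λ n p → begin-strict
      ∣ seq x n - seq z n ∣                              ≡⟨ cong ∣_∣ (diff-trans (seq x n) (seq y n) (seq z n)) ⟩
      ∣ (seq x n - seq y n) + (seq y n - seq z n) ∣      ≤⟨ ℚ.∣p+q∣≤∣p∣+∣q∣ (seq x n - seq y n) _ ⟩
      ∣ seq x n - seq y n ∣ + ∣ seq y n - seq z n ∣      <⟨ ℚ.+-mono-< (h n (ℕ.m⊔n≤o⇒m≤o M N p)) (k n (ℕ.m⊔n≤o⇒n≤o M N p)) ⟩
      ½ * ε + ½ * ε                                      ≡⟨ half+half ε ⟩
      ε                                                  ∎
    where open ℚ.≤-Reasoning

  +ᴿ-cong : ∀ {x y u v} → x ≈ᴿ y → u ≈ᴿ v → x +ᴿ u ≈ᴿ y +ᴿ v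
  +ᴿ-cong {x} {y} {u} {v} x≈y u≈v = mk≈ᴿ λ ε 0<ε →
    let M , h = close x≈y (½ * ε) (half-pos 0<ε)
        N , k = close u≈v (½ * ε) (half-pos 0<ε)
    in M ℕ.⊔ N , λ n p → begin-strict
      ∣ (seq x n + seq u n) - (seq y n + seq v n) ∣      ≡⟨ cong ∣_∣ (Identities.sum-diff (seq x n) (seq u n) (seq y n) (seq v n)) ⟩
      ∣ (seq x n - seq y n) + (seq u n - seq v n) ∣      ≤⟨ ℚ.∣p+q∣≤∣p∣+∣q∣ (seq x n - seq y n) _ ⟩
      ∣ seq x n - seq y n ∣ + ∣ seq u n - seq v n ∣      <⟨ ℚ.+-mono-< (h n (ℕ.m⊔n≤o⇒m≤o M N p)) (k n (ℕ.m⊔n≤o⇒n≤o M N p)) ⟩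
      ½ * ε + ½ * ε                                      ≡⟨ half+half ε ⟩
      ε                                                  ∎
    where open ℚ.≤-Reasoning

  -ᴿ-cong : ∀ {x y} → x ≈ᴿ y → -ᴿ x ≈ᴿ -ᴿ y
  -ᴿ-cong {x} {y} x≈y = mk≈ᴿ λ ε 0<ε → let N , h = close x≈y ε 0<ε in N , λ n p → begin-strict
    ∣ - seq x n - (- seq y n) ∣    ≡⟨ cong ∣_∣ (ℚ.neg-distrib-+ (seq x n) (- seq y n)) ⟨
    ∣ - (seq x n - seq y n) ∣      ≡⟨ ℚ.∣-p∣≡∣p∣ (seq x n - seq y n) ⟩
    ∣ seq x n - seq y n ∣          <⟨ h n p ⟩
    ε                              ∎
    where open ℚ.≤-Reasoning

  *ᴿ-cong : ∀ {x y u v} → x ≈ᴿ y → u ≈ᴿ v → x *ᴿ u ≈ᴿ y *ᴿ v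
  *ᴿ-cong {x} {y} {u} {v} x≈y u≈v = mk≈ᴿ λ ε 0<ε →
    let A , K , 0<A , bx = eventually-bounded (seq x) (cauchy x)
        B , L , 0<B , bv = eventually-bounded (seq v) (cauchy v)
        δ , 0<δ , eq     = rescale (ℚ.+-mono-< 0<A 0<B) 0<ε
        M , h            = close x≈y δ 0<δ
        N , k            = close u≈v δ 0<δ
    in (K ℕ.⊔ L) ℕ.⊔ (M ℕ.⊔ N) , λ n p →
      let K≤n , L≤n , M≤n , N≤n = ⊔⁴-bounds K L M N p
      in product-close (seq x n) (seq u n) (seq y n) (seq v n) (bx n K≤n) (bv n L≤n) (k n N≤n) (h n M≤n) eq

  ≈ᴿ-isEquivalence : IsEquivalence _≈ᴿ_
  ≈ᴿ-isEquivalence = record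
    { refl  = λ {x} → ≈ᴿ-refl {x}
    ; sym   = λ {x} {y} → ≈ᴿ-sym {x} {y}
    ; trans = λ {x} {y} {z} → ≈ᴿ-trans {x} {y} {z}
    }

  ≈-refl : ∀ {z} → z ≈ z
  ≈-refl {z} = mk≈ (≈ᴿ-refl {re z}) (≈ᴿ-refl {im z})

  ≈-sym : ∀ {z w} → z ≈ w → w ≈ z
  ≈-sym {z} {w} e = mk≈ (≈ᴿ-sym {re z} {re w} (re≈ e)) (≈ᴿ-sym {im z} {im w} (im≈ e))

  ≈-trans : ∀ {u v w} → u ≈ v → v ≈ w → u ≈ w
  ≈-trans {u} {v} {w} e f = mk≈ (≈ᴿ-trans {re u} {re v} {re w} (re≈ e) (re≈ f))
                                (≈ᴿ-trans {im u} {im v} {im w} (im≈ e) (im≈ f))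

  ≈-isEquivalence : IsEquivalence _≈_
  ≈-isEquivalence = record
    { refl  = λ {z} → ≈-refl {z}
    ; sym   = λ {z} {w} → ≈-sym {z} {w}
    ; trans = λ {u} {v} {w} → ≈-trans {u} {v} {w}
    }

  ℝ-isCommutativeRing : IsCommutativeRing _≈ᴿ_ _+ᴿ_ _*ᴿ_ -ᴿ_ 0ᴿ 1ᴿ
  ℝ-isCommutativeRing = record
    { isRing = record
      { +-isAbelianGroup = record
        { isGroup = record
          { isMonoid = record
            { isSemigroup = record
              { isMagma = record
                { isEquivalence = ≈ᴿ-isEquivalence
                ; ∙-cong = λ {x} {y} {u} {v} → +ᴿ-cong {x} {y} {u} {v} }
              ; assoc = λ x y z → pointwise {(x +ᴿ y) +ᴿ z} {x +ᴿ (y +ᴿ z)}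
                  λ n → ℚ.+-assoc (seq x n) (seq y n) (seq z n) }
            ; identity = (λ x → pointwise {0ᴿ +ᴿ x} {x} λ n → ℚ.+-identityˡ (seq x n))
                       , (λ x → pointwise {x +ᴿ 0ᴿ} {x} λ n → ℚ.+-identityʳ (seq x n)) }
          ; inverse = (λ x → pointwise { -ᴿ x +ᴿ x} {0ᴿ} λ n → ℚ.+-inverseˡ (seq x n))
                    , (λ x → pointwise {x +ᴿ -ᴿ x} {0ᴿ} λ n → ℚ.+-inverseʳ (seq x n))
          ; ⁻¹-cong = λ {x} {y} → -ᴿ-cong {x} {y} }
        ; comm = λ x y → pointwise {x +ᴿ y} {y +ᴿ x} λ n → ℚ.+-comm (seq x n) (seq y n) }
      ; *-cong = λ {x} {y} {u} {v} → *ᴿ-cong {x} {y} {u} {v}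
      ; *-assoc = λ x y z → pointwise {(x *ᴿ y) *ᴿ z} {x *ᴿ (y *ᴿ z)}
          λ n → ℚ.*-assoc (seq x n) (seq y n) (seq z n)
      ; *-identity = (λ x → pointwise {1ᴿ *ᴿ x} {x} λ n → ℚ.*-identityˡ (seq x n))
                   , (λ x → pointwise {x *ᴿ 1ᴿ} {x} λ n → ℚ.*-identityʳ (seq x n))
      ; distrib = (λ x y z → pointwise {x *ᴿ (y +ᴿ z)} {x *ᴿ y +ᴿ x *ᴿ z}
                     λ n → ℚ.*-distribˡ-+ (seq x n) (seq y n) (seq z n))
                , (λ x y z → pointwise {(y +ᴿ z) *ᴿ x} {y *ᴿ x +ᴿ z *ᴿ x}
                     λ n → ℚ.*-distribʳ-+ (seq x n) (seq y n) (seq z n)) }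
    ; *-comm = λ x y → pointwise {x *ᴿ y} {y *ᴿ x} λ n → ℚ.*-comm (seq x n) (seq y n) }

  module ℝ-Algebra = ℚ-Algebra _≈ᴿ_ _+ᴿ_ _*ᴿ_ -ᴿ_ 0ᴿ 1ᴿ ℝ-isCommutativeRing fromℚ
    (λ p q → pointwise {fromℚ (p + q)} {fromℚ p +ᴿ fromℚ q} λ _ → refl)
    (λ p q → pointwise {fromℚ (p * q)} {fromℚ p *ᴿ fromℚ q} λ _ → refl)
    (λ p → pointwise {fromℚ (- p)} { -ᴿ fromℚ p} λ _ → refl)
    (≈ᴿ-refl {0ᴿ}) (≈ᴿ-refl {1ᴿ})

  module _ where
    open +-*-Solver

    *-assoc-re : ∀ a b c d e f → (a * c + - (b * d)) * e + - ((a * d + b * c) * f)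
                               ≡ a * (c * e + - (d * f)) + - (b * (c * f + d * e))
    *-assoc-re = solve 6 (λ a b c d e f → (a :* c :+ :- (b :* d)) :* e :+ :- ((a :* d :+ b :* c) :* f)
      := a :* (c :* e :+ :- (d :* f)) :+ :- (b :* (c :* f :+ d :* e))) refl

    *-assoc-im : ∀ a b c d e f → (a * c + - (b * d)) * f + (a * d + b * c) * e
                               ≡ a * (c * f + d * e) + b * (c * e + - (d * f))
    *-assoc-im = solve 6 (λ a b c d e f → (a :* c :+ :- (b :* d)) :* f :+ (a :* d :+ b :* c) :* e
      := a :* (c :* f :+ d :* e) :+ b :* (c :* e :+ :- (d :* f))) refl

    *-comm-re : ∀ a b c d → a * c + - (b * d) ≡ c * a + - (d * b)
    *-comm-re = solve 4 (λ a b c d → a :* c :+ :- (b :* d) := c :* a :+ :- (d :* b)) refl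

    *-comm-im : ∀ a b c d → a * d + b * c ≡ c * b + d * a
    *-comm-im = solve 4 (λ a b c d → a :* d :+ b :* c := c :* b :+ d :* a) refl

    *-identity-re : ∀ a b → 1ℚ * a + - (0ℚ * b) ≡ a
    *-identity-re = solve 2 (λ a b → con 1ℚ :* a :+ :- (con 0ℚ :* b) := a) refl

    *-identity-im : ∀ a b → 1ℚ * b + 0ℚ * a ≡ b
    *-identity-im = solve 2 (λ a b → con 1ℚ :* b :+ con 0ℚ :* a := b) refl

    *-distrib-re : ∀ a b c d e f → a * (c + e) + - (b * (d + f)) ≡ (a * c + - (b * d)) + (a * e + - (b * f))
    *-distrib-re = solve 6 (λ a b c d e f → a :* (c :+ e) :+ :- (b :* (d :+ f))
      := (a :* c :+ :- (b :* d)) :+ (a :* e :+ :- (b :* f))) refl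

    *-distrib-im : ∀ a b c d e f → a * (d + f) + b * (c + e) ≡ (a * d + b * c) + (a * f + b * e)
    *-distrib-im = solve 6 (λ a b c d e f → a :* (d :+ f) :+ b :* (c :+ e)
      := (a :* d :+ b :* c) :+ (a :* f :+ b :* e)) refl

    scaled-𝕚-re : ∀ r s → r * s * 0ℚ + - (0ℚ * 1ℚ) ≡ r * (s * 0ℚ + - (0ℚ * 1ℚ)) + - (0ℚ * (s * 1ℚ + 0ℚ * 0ℚ))
    scaled-𝕚-re = solve 2 (λ r s → r :* s :* con 0ℚ :+ :- (con 0ℚ :* con 1ℚ)
      := r :* (s :* con 0ℚ :+ :- (con 0ℚ :* con 1ℚ)) :+ :- (con 0ℚ :* (s :* con 1ℚ :+ con 0ℚ :* con 0ℚ))) refl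

    scaled-𝕚-im : ∀ r s → r * s * 1ℚ + 0ℚ * 0ℚ ≡ r * (s * 1ℚ + 0ℚ * 0ℚ) + 0ℚ * (s * 0ℚ + - (0ℚ * 1ℚ))
    scaled-𝕚-im = solve 2 (λ r s → r :* s :* con 1ℚ :+ con 0ℚ :* con 0ℚ
      := r :* (s :* con 1ℚ :+ con 0ℚ :* con 0ℚ) :+ con 0ℚ :* (s :* con 0ℚ :+ :- (con 0ℚ :* con 1ℚ))) refl

  +ᶜ-cong : ∀ {x y u v} → x ≈ y → u ≈ v → x +ᶜ u ≈ y +ᶜ v
  +ᶜ-cong {x} {y} {u} {v} e f = mk≈
    (+ᴿ-cong {re x} {re y} {re u} {re v} (re≈ e) (re≈ f))
    (+ᴿ-cong {im x} {im y} {im u} {im v} (im≈ e) (im≈ f))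

  -ᶜ-cong : ∀ {x y} → x ≈ y → -ᶜ x ≈ -ᶜ y
  -ᶜ-cong {x} {y} e = mk≈ (-ᴿ-cong {re x} {re y} (re≈ e)) (-ᴿ-cong {im x} {im y} (im≈ e))

  *ᶜ-cong : ∀ {x y u v} → x ≈ y → u ≈ v → x *ᶜ u ≈ y *ᶜ v
  *ᶜ-cong {x} {y} {u} {v} e f = mk≈
    (+ᴿ-cong {re x *ᴿ re u} {re y *ᴿ re v} { -ᴿ (im x *ᴿ im u)} { -ᴿ (im y *ᴿ im v)}
      (*ᴿ-cong {re x} {re y} {re u} {re v} (re≈ e) (re≈ f))
      (-ᴿ-cong {im x *ᴿ im u} {im y *ᴿ im v} (*ᴿ-cong {im x} {im y} {im u} {im v} (im≈ e) (im≈ f))))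
    (+ᴿ-cong {re x *ᴿ im u} {re y *ᴿ im v} {im x *ᴿ re u} {im y *ᴿ re v}
      (*ᴿ-cong {re x} {re y} {im u} {im v} (re≈ e) (im≈ f))
      (*ᴿ-cong {im x} {im y} {re u} {re v} (im≈ e) (re≈ f)))

  pointwiseᶜ : ∀ z w → (∀ n → seq (re z) n ≡ seq (re w) n) → (∀ n → seq (im z) n ≡ seq (im w) n) → z ≈ w
  pointwiseᶜ z w h k = mk≈ (pointwise {re z} {re w} h) (pointwise {im z} {im w} k)

  private
    *ᶜ-assoc : ∀ x y z → (x *ᶜ y) *ᶜ z ≈ x *ᶜ (y *ᶜ z)
    *ᶜ-assoc x y z = pointwiseᶜ ((x *ᶜ y) *ᶜ z) (x *ᶜ (y *ᶜ z))
      (λ n → *-assoc-re (seq (re x) n) (seq (im x) n) (seq (re y) n) (seq (im y) n) (seq (re z) n) (seq (im z) n))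
      (λ n → *-assoc-im (seq (re x) n) (seq (im x) n) (seq (re y) n) (seq (im y) n) (seq (re z) n) (seq (im z) n))

    *ᶜ-comm : ∀ x y → x *ᶜ y ≈ y *ᶜ x
    *ᶜ-comm x y = pointwiseᶜ (x *ᶜ y) (y *ᶜ x)
      (λ n → *-comm-re (seq (re x) n) (seq (im x) n) (seq (re y) n) (seq (im y) n))
      (λ n → *-comm-im (seq (re x) n) (seq (im x) n) (seq (re y) n) (seq (im y) n))

    *ᶜ-identityˡ : ∀ x → 1ᶜ *ᶜ x ≈ x
    *ᶜ-identityˡ x = pointwiseᶜ (1ᶜ *ᶜ x) x
      (λ n → *-identity-re (seq (re x) n) (seq (im x) n))
      (λ n → *-identity-im (seq (re x) n) (seq (im x) n))

    *ᶜ-distribˡ : ∀ x y z → x *ᶜ (y +ᶜ z) ≈ x *ᶜ y +ᶜ x *ᶜ z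
    *ᶜ-distribˡ x y z = pointwiseᶜ (x *ᶜ (y +ᶜ z)) (x *ᶜ y +ᶜ x *ᶜ z)
      (λ n → *-distrib-re (seq (re x) n) (seq (im x) n) (seq (re y) n) (seq (im y) n) (seq (re z) n) (seq (im z) n))
      (λ n → *-distrib-im (seq (re x) n) (seq (im x) n) (seq (re y) n) (seq (im y) n) (seq (re z) n) (seq (im z) n))

    *ᶜ-identityʳ : ∀ x → x *ᶜ 1ᶜ ≈ x
    *ᶜ-identityʳ x = ≈-trans {x *ᶜ 1ᶜ} {1ᶜ *ᶜ x} {x} (*ᶜ-comm x 1ᶜ) (*ᶜ-identityˡ x)

    *ᶜ-distribʳ : ∀ x y z → (y +ᶜ z) *ᶜ x ≈ y *ᶜ x +ᶜ z *ᶜ x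
    *ᶜ-distribʳ x y z = ≈-trans {(y +ᶜ z) *ᶜ x} {x *ᶜ (y +ᶜ z)} {y *ᶜ x +ᶜ z *ᶜ x} (*ᶜ-comm (y +ᶜ z) x)
      (≈-trans {x *ᶜ (y +ᶜ z)} {x *ᶜ y +ᶜ x *ᶜ z} {y *ᶜ x +ᶜ z *ᶜ x} (*ᶜ-distribˡ x y z)
        (+ᶜ-cong {x *ᶜ y} {y *ᶜ x} {x *ᶜ z} {z *ᶜ x} (*ᶜ-comm x y) (*ᶜ-comm x z)))

  ℂ-isCommutativeRing : IsCommutativeRing _≈_ _+ᶜ_ _*ᶜ_ -ᶜ_ 0ᶜ 1ᶜ
  ℂ-isCommutativeRing = record
    { isRing = record
      { +-isAbelianGroup = record
        { isGroup = record
          { isMonoid = record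
            { isSemigroup = record
              { isMagma = record
                { isEquivalence = ≈-isEquivalence
                ; ∙-cong = λ {x} {y} {u} {v} → +ᶜ-cong {x} {y} {u} {v} }
              ; assoc = λ x y z → pointwiseᶜ ((x +ᶜ y) +ᶜ z) (x +ᶜ (y +ᶜ z))
                  (λ n → ℚ.+-assoc (seq (re x) n) (seq (re y) n) (seq (re z) n))
                  (λ n → ℚ.+-assoc (seq (im x) n) (seq (im y) n) (seq (im z) n)) }
            ; identity = (λ x → pointwiseᶜ (0ᶜ +ᶜ x) x (λ n → ℚ.+-identityˡ (seq (re x) n)) (λ n → ℚ.+-identityˡ (seq (im x) n)))
                       , (λ x → pointwiseᶜ (x +ᶜ 0ᶜ) x (λ n → ℚ.+-identityʳ (seq (re x) n)) (λ n → ℚ.+-identityʳ (seq (im x) n))) }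
          ; inverse = (λ x → pointwiseᶜ (-ᶜ x +ᶜ x) 0ᶜ (λ n → ℚ.+-inverseˡ (seq (re x) n)) (λ n → ℚ.+-inverseˡ (seq (im x) n)))
                    , (λ x → pointwiseᶜ (x +ᶜ -ᶜ x) 0ᶜ (λ n → ℚ.+-inverseʳ (seq (re x) n)) (λ n → ℚ.+-inverseʳ (seq (im x) n)))
          ; ⁻¹-cong = λ {x} {y} → -ᶜ-cong {x} {y} }
        ; comm = λ x y → pointwiseᶜ (x +ᶜ y) (y +ᶜ x)
            (λ n → ℚ.+-comm (seq (re x) n) (seq (re y) n)) (λ n → ℚ.+-comm (seq (im x) n) (seq (im y) n)) }
      ; *-cong = λ {x} {y} {u} {v} → *ᶜ-cong {x} {y} {u} {v}
      ; *-assoc = *ᶜ-assoc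
      ; *-identity = *ᶜ-identityˡ , *ᶜ-identityʳ
      ; distrib = *ᶜ-distribˡ , *ᶜ-distribʳ }
    ; *-comm = *ᶜ-comm }

  ι : ℚ → ℂ
  ι q = fromℝ (fromℚ q)

  ι-+ : ∀ p q → ι (p + q) ≈ ι p +ᶜ ι q
  ι-+ p q = pointwiseᶜ (ι (p + q)) (ι p +ᶜ ι q) (λ _ → refl) (λ _ → refl)

  ι-* : ∀ p q → ι (p * q) ≈ ι p *ᶜ ι q
  ι-* p q = pointwiseᶜ (ι (p * q)) (ι p *ᶜ ι q)
    (λ _ → sym (ℚ.+-identityʳ (p * q)))
    (λ _ → sym (cong₂ _+_ (ℚ.*-zeroʳ p) (ℚ.*-zeroˡ q)))

  ι-neg : ∀ p → ι (- p) ≈ -ᶜ ι p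
  ι-neg p = pointwiseᶜ (ι (- p)) (-ᶜ ι p) (λ _ → refl) (λ _ → refl)

  module ℂ-Algebra = ℚ-Algebra _≈_ _+ᶜ_ _*ᶜ_ -ᶜ_ 0ᶜ 1ᶜ ℂ-isCommutativeRing ι ι-+ ι-* ι-neg (≈-refl {0ᶜ}) (≈-refl {1ᶜ})

  -- Positivity and apartness of real numbers.

  p≤∣p∣ : ∀ p → p ≤ ∣ p ∣
  p≤∣p∣ p with ℚ.≤-total 0ℚ p
  ... | inj₁ 0≤p = ℚ.≤-reflexive (sym (ℚ.0≤p⇒∣p∣≡p 0≤p))
  ... | inj₂ p≤0 = ℚ.≤-trans p≤0 (ℚ.0≤∣p∣ p)

  ∣p∣<q : ∀ {p q} → p < q → - p < q → ∣ p ∣ < q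
  ∣p∣<q {p} {q} p<q -p<q with ℚ.∣p∣≡p∨∣p∣≡-p p
  ... | inj₁ eq = subst (_< q) (sym eq) p<q
  ... | inj₂ eq = subst (_< q) (sym eq) -p<q

  0≤p*p : ∀ p → 0ℚ ≤ p * p
  0≤p*p p with ℚ.≤-total 0ℚ p
  ... | inj₁ 0≤p = subst (_≤ p * p) (ℚ.*-zeroˡ p) (ℚ.*-monoʳ-≤-nonNeg p {{ℚ.nonNegative 0≤p}} 0≤p)
  ... | inj₂ p≤0 = subst (_≤ p * p) (ℚ.*-zeroˡ p) (ℚ.*-monoʳ-≤-nonPos p {{ℚ.nonPositive p≤0}} p≤0)

  *-positive : ∀ {p q} → 0ℚ < p → 0ℚ < q → 0ℚ < p * q
  *-positive {p} {q} 0<p 0<q = ℚ.positive⁻¹ (p * q) {{ℚ.pos*pos⇒pos p {{ℚ.positive 0<p}} q {{ℚ.positive 0<q}}}}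

  half-< : ∀ {p} → 0ℚ < p → ½ * p < p
  half-< {p} 0<p = subst₂ _<_ (ℚ.+-identityʳ (½ * p)) (half+half p) (ℚ.+-monoʳ-< (½ * p) (half-pos 0<p))

  ∃-min : ∀ {p q} → 0ℚ < p → 0ℚ < q → ∃[ r ] (0ℚ < r × r ≤ p × r ≤ q)
  ∃-min {p} {q} 0<p 0<q with ℚ.≤-total p q
  ... | inj₁ p≤q = p , 0<p , ℚ.≤-refl , p≤q
  ... | inj₂ q≤p = q , 0<q , q≤p , ℚ.≤-refl

  close-to-large : ∀ {ε a b} → ε ≤ a → ∣ a - b ∣ < ½ * ε → ½ * ε ≤ b
  close-to-large {ε} {a} {b} ε≤a ab< = begin
    ½ * ε                          ≡⟨ cancel (½ * ε) ⟨
    (½ * ε + ½ * ε) - ½ * ε        ≡⟨ cong (_- ½ * ε) (half+half ε) ⟩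
    ε - ½ * ε                      ≤⟨ ℚ.+-mono-≤ ε≤a (ℚ.neg-antimono-≤ (ℚ.≤-trans (p≤∣p∣ (a - b)) (ℚ.<⇒≤ ab<))) ⟩
    a - (a - b)                    ≡⟨ cancel′ a b ⟩
    b                              ∎
    where
    open ℚ.≤-Reasoning
    open +-*-Solver
    cancel : ∀ h → (h + h) - h ≡ h
    cancel = solve 1 (λ h → (h :+ h) :- h := h) refl
    cancel′ : ∀ a b → a - (a - b) ≡ b
    cancel′ = solve 2 (λ a b → a :- (a :- b) := b) refl

  -- Positivity as data, since the order of Cauchy sequences is not decidable. An explicit rational
  -- bound can be multiplied, carried along `_≈ᴿ_` and used to cancel a factor.
  record Pos (x : ℝ) : Set where
    constructor mkPos
    field
      bound   : ℚ
      0<bound : 0ℚ < bound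
      start   : ℕ
      bounded : ∀ n → start ℕ.≤ n → bound ≤ seq x n

  Pos-resp : ∀ {x y} → x ≈ᴿ y → Pos x → Pos y
  Pos-resp {x} {y} x≈y (mkPos ε 0<ε N ε≤x) =
    let M , h = close x≈y (½ * ε) (half-pos 0<ε)
    in mkPos (½ * ε) (half-pos 0<ε) (M ℕ.⊔ N) λ n p →
         close-to-large (ε≤x n (ℕ.m⊔n≤o⇒n≤o M N p)) (h n (ℕ.m⊔n≤o⇒m≤o M N p))

  Pos-fromℚ : ∀ {q} → 0ℚ < q → Pos (fromℚ q)
  Pos-fromℚ {q} 0<q = mkPos q 0<q 0 λ _ _ → ℚ.≤-refl

  Pos-fromℚ⁻¹ : ∀ {q} → Pos (fromℚ q) → 0ℚ < q
  Pos-fromℚ⁻¹ (mkPos ε 0<ε N ε≤q) = ℚ.<-≤-trans 0<ε (ε≤q N ℕ.≤-refl)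

  Pos⇒≉0 : ∀ {x} → Pos x → ¬ (x ≈ᴿ 0ᴿ)
  Pos⇒≉0 {x} x>0 x≈0 = ℚ.<-irrefl refl (Pos-fromℚ⁻¹ (Pos-resp {x} {0ᴿ} x≈0 x>0))

  Pos⇒0≤ : ∀ {x} → Pos x → 0ᴿ ≤ᴿ x
  Pos⇒0≤ (mkPos ε 0<ε N ε≤x) = mk≤ᴿ λ η 0<η → N , λ n p →
    ℚ.+-mono-< (ℚ.<-≤-trans 0<ε (ε≤x n p)) 0<η

  Pos-* : ∀ {x y} → Pos x → Pos y → Pos (x *ᴿ y)
  Pos-* {x} {y} (mkPos ε 0<ε M ε≤x) (mkPos η 0<η N η≤y) =
    mkPos (ε * η) (*-positive 0<ε 0<η) (M ℕ.⊔ N) λ n p →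
      let ε≤xₙ = ε≤x n (ℕ.m⊔n≤o⇒m≤o M N p)
          η≤yₙ = η≤y n (ℕ.m⊔n≤o⇒n≤o M N p)
      in ℚ.≤-trans
        (ℚ.*-monoʳ-≤-nonNeg η {{ℚ.nonNegative (ℚ.<⇒≤ 0<η)}} ε≤xₙ)
        (ℚ.*-monoˡ-≤-nonNeg (seq x n) {{ℚ.nonNegative (ℚ.≤-trans (ℚ.<⇒≤ 0<ε) ε≤xₙ)}} η≤yₙ)

  Pos-+-nonNeg : ∀ {x y} → Pos x → ∃[ N ] (∀ n → N ℕ.≤ n → 0ℚ ≤ seq y n) → Pos (x +ᴿ y)
  Pos-+-nonNeg {x} {y} (mkPos ε 0<ε M ε≤x) (N , 0≤y) = mkPos ε 0<ε (M ℕ.⊔ N) λ n p →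
    subst (_≤ seq x n + seq y n) (ℚ.+-identityʳ ε)
      (ℚ.+-mono-≤ (ε≤x n (ℕ.m⊔n≤o⇒m≤o M N p)) (0≤y n (ℕ.m⊔n≤o⇒n≤o M N p)))

  -- The alternatives overlap, so a single rational term decides between them. It is taken so late
  -- that the sequence moves by less than ε/4 afterwards: if its absolute value is at least ε/2, the
  -- sequence stays beyond ε/4 on the same side; otherwise it stays below ε in absolute value.
  small-or-apart : ∀ x {ε} → 0ℚ < ε → (∃[ N ] (∀ n → N ℕ.≤ n → ∣ seq x n ∣ < ε)) ⊎ (Pos x ⊎ Pos (-ᴿ x))
  small-or-apart x {ε} 0<ε
    with N , h ← cauchy x (½ * (½ * ε)) (half-pos (half-pos 0<ε))
    with ½ * ε ℚ.≤? seq x N | ½ * ε ℚ.≤? - seq x N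
  ... | yes large | _ = inj₂ (inj₁ (mkPos (½ * (½ * ε)) (half-pos (half-pos 0<ε)) N λ n p →
    close-to-large large (h N n ℕ.≤-refl p)))
  ... | no _ | yes large = inj₂ (inj₂ (mkPos (½ * (½ * ε)) (half-pos (half-pos 0<ε)) N λ n p →
    close-to-large large (subst (_< ½ * (½ * ε)) (neg-distance (seq x N) (seq x n)) (h N n ℕ.≤-refl p))))
    where
    neg-distance : ∀ a b → ∣ a - b ∣ ≡ ∣ - a - (- b) ∣
    neg-distance a b = trans (sym (ℚ.∣-p∣≡∣p∣ (a - b))) (cong ∣_∣ (ℚ.neg-distrib-+ a (- b)))
  ... | no small | no small′ = inj₁ (N , λ n p → begin-strict
    ∣ seq x n ∣                          ≡⟨ cong ∣_∣ (Identities.split (seq x n) (seq x N)) ⟩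
    ∣ (seq x n - seq x N) + seq x N ∣    ≤⟨ ℚ.∣p+q∣≤∣p∣+∣q∣ (seq x n - seq x N) (seq x N) ⟩
    ∣ seq x n - seq x N ∣ + ∣ seq x N ∣  <⟨ ℚ.+-mono-< (ℚ.<-trans (h n N p ℕ.≤-refl) (half-< (half-pos 0<ε)))
                                              (∣p∣<q (ℚ.≰⇒> small) (ℚ.≰⇒> small′)) ⟩
    ½ * ε + ½ * ε                        ≡⟨ half+half ε ⟩
    ε                                    ∎)
    where open ℚ.≤-Reasoning

  ≈0-intro : ∀ {x} → (∀ ε → 0ℚ < ε → ∃[ N ] (∀ n → N ℕ.≤ n → ∣ seq x n ∣ < ε)) → x ≈ᴿ 0ᴿ
  ≈0-intro {x} h = mk≈ᴿ λ ε 0<ε → let N , small = h ε 0<ε in N , λ n p →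
    subst (λ a → ∣ a ∣ < ε) (sym (ℚ.+-identityʳ (seq x n))) (small n p)

  ≈0-elim : ∀ {x} → x ≈ᴿ 0ᴿ → ∀ ε → 0ℚ < ε → ∃[ N ] (∀ n → N ℕ.≤ n → ∣ seq x n ∣ < ε)
  ≈0-elim {x} x≈0 ε 0<ε = let N , h = close x≈0 ε 0<ε in N , λ n p →
    subst (λ a → ∣ a ∣ < ε) (ℚ.+-identityʳ (seq x n)) (h n p)

  -- Apartness is tight: with the second alternative excluded, `small-or-apart` bounds x by every
  -- positive ε.
  ¬apart⇒≈0 : ∀ x → ¬ (Pos x ⊎ Pos (-ᴿ x)) → x ≈ᴿ 0ᴿ
  ¬apart⇒≈0 x ¬apart = ≈0-intro {x} λ ε 0<ε →
    [ (λ small → small) , (λ apart → contradiction apart ¬apart) ]′ (small-or-apart x 0<ε)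

  -- Instead of dividing by y, its lower bound ε is cancelled from ∣x∣ ε ≤ ∣x y∣ < δ ε.
  x*y≈0⇒x≈0 : ∀ x y → x *ᴿ y ≈ᴿ 0ᴿ → Pos y → x ≈ᴿ 0ᴿ
  x*y≈0⇒x≈0 x y xy≈0 (mkPos ε 0<ε M ε≤y) = ≈0-intro {x} λ δ 0<δ →
    let N , h = ≈0-elim {x *ᴿ y} xy≈0 (δ * ε) (*-positive 0<δ 0<ε)
    in M ℕ.⊔ N , λ n p → ℚ.*-cancelʳ-<-nonNeg ε {{ℚ.nonNegative (ℚ.<⇒≤ 0<ε)}} (begin-strict
      ∣ seq x n ∣ * ε                ≤⟨ ℚ.*-monoˡ-≤-nonNeg ∣ seq x n ∣ {{ℚ.∣-∣-nonNeg (seq x n)}}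
                                          (ℚ.≤-trans (ε≤y n (ℕ.m⊔n≤o⇒m≤o M N p)) (p≤∣p∣ (seq y n))) ⟩
      ∣ seq x n ∣ * ∣ seq y n ∣      ≡⟨ ℚ.∣p*q∣≡∣p∣*∣q∣ (seq x n) (seq y n) ⟨
      ∣ seq x n * seq y n ∣          <⟨ h n (ℕ.m⊔n≤o⇒n≤o M N p) ⟩
      δ * ε                          ∎)
    where open ℚ.≤-Reasoning

  -- Square roots of rational numbers.

  Pos-square⁻¹ : ∀ x → Pos (x *ᴿ x) → Pos x ⊎ Pos (-ᴿ x)
  Pos-square⁻¹ x (mkPos ε 0<ε M ε≤x²)
    -- A bound δ below both ε and 1 replaces the square root of ε: ∣x∣ < δ would give x² < δ² ≤ δ ≤
    -- ε.
    with δ , 0<δ , δ≤ε , δ≤1 ← ∃-min 0<ε 0<1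
    with small-or-apart x 0<δ
  ... | inj₂ apart       = apart
  ... | inj₁ (N , small) = contradiction (begin-strict
    ε                        ≤⟨ ε≤x² n (ℕ.m≤m⊔n M N) ⟩
    seq x n * seq x n        ≤⟨ p≤∣p∣ (seq x n * seq x n) ⟩
    ∣ seq x n * seq x n ∣    ≡⟨ ℚ.∣p*q∣≡∣p∣*∣q∣ (seq x n) (seq x n) ⟩
    ∣ seq x n ∣ * ∣ seq x n ∣  <⟨ *-mono-< (ℚ.0≤∣p∣ (seq x n)) x<δ (ℚ.0≤∣p∣ (seq x n)) x<δ ⟩
    δ * δ                    ≤⟨ ℚ.*-monoˡ-≤-nonNeg δ {{ℚ.nonNegative (ℚ.<⇒≤ 0<δ)}} δ≤1 ⟩
    δ * 1ℚ                   ≡⟨ ℚ.*-identityʳ δ ⟩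
    δ                        ≤⟨ δ≤ε ⟩
    ε                        ∎) (ℚ.<-irrefl refl)
    where
    open ℚ.≤-Reasoning
    n = M ℕ.⊔ N
    x<δ = small n (ℕ.m≤n⊔m M N)

  apart⇒Pos-square : ∀ x → Pos x ⊎ Pos (-ᴿ x) → Pos (x *ᴿ x)
  apart⇒Pos-square x (inj₁ x>0) = Pos-* {x} {x} x>0 x>0
  apart⇒Pos-square x (inj₂ x<0) = Pos-resp { -ᴿ x *ᴿ -ᴿ x} {x *ᴿ x} (ℝ-Algebra.neg-square x)
    (Pos-* { -ᴿ x} { -ᴿ x} x<0 x<0)

  x*y≈0∧y-apart⇒x≈0 : ∀ x y → x *ᴿ y ≈ᴿ 0ᴿ → Pos y ⊎ Pos (-ᴿ y) → x ≈ᴿ 0ᴿ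
  x*y≈0∧y-apart⇒x≈0 x y xy≈0 (inj₁ y>0) = x*y≈0⇒x≈0 x y xy≈0 y>0
  x*y≈0∧y-apart⇒x≈0 x y xy≈0 (inj₂ y<0) = x*y≈0⇒x≈0 x (-ᴿ y) (ℝ-Algebra.neg-zero x y xy≈0) y<0

  -- In (t - r)(t + r) ≈ 0 the second factor is positive and can be cancelled.
  rational-square-root : ∀ t r → Pos t → 0ℚ < r → t *ᴿ t ≈ᴿ fromℚ (r * r) → t ≈ᴿ fromℚ r
  rational-square-root t r t>0 0<r t² = ℝ-Algebra.difference-zero t (fromℚ r)
    (x*y≈0⇒x≈0 (t +ᴿ -ᴿ fromℚ r) (t +ᴿ fromℚ r) (ℝ-Algebra.difference-of-squares t r t²)
      (Pos-+-nonNeg {t} {fromℚ r} t>0 (0 , λ _ _ → ℚ.<⇒≤ 0<r)))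

  fromℝ-*-𝕚 : ∀ x y → x ≈ᴿ 0ᴿ → (x +i y) ≈ fromℝ y *ᶜ 𝕚
  fromℝ-*-𝕚 x y x≈0 = ≈-trans {x +i y} {0ᴿ +i y} {fromℝ y *ᶜ 𝕚} (mk≈ x≈0 (≈ᴿ-refl {y}))
    (pointwiseᶜ (0ᴿ +i y) (fromℝ y *ᶜ 𝕚)
      (λ n → sym (cong (_+ - (0ℚ * 1ℚ)) (ℚ.*-zeroʳ (seq y n))))
      (λ n → sym (trans (ℚ.+-identityʳ (seq y n * 1ℚ)) (ℚ.*-identityʳ (seq y n)))))

  -- The hypotheses say (x + y i)² = D.
  module _ (x y : ℝ) (D : ℚ) (re-square : x *ᴿ x +ᴿ -ᴿ (y *ᴿ y) ≈ᴿ fromℚ D) (im-square : x *ᴿ y +ᴿ y *ᴿ x ≈ᴿ 0ᴿ) where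

    re≈0 : Pos y ⊎ Pos (-ᴿ y) → x ≈ᴿ 0ᴿ
    re≈0 = x*y≈0∧y-apart⇒x≈0 x y (ℝ-Algebra.half-zero x y im-square)

    im-square≈ : Pos y ⊎ Pos (-ᴿ y) → y *ᴿ y ≈ᴿ fromℚ (- D)
    im-square≈ apart = ℝ-Algebra.imaginary-square x y D re-square (re≈0 apart)

    -- If y were apart from 0, x would vanish and y² ≈ - D would be positive, although - D ≤ 0.
    -- Tightness of apartness turns this into y ≈ 0.
    root-of-nonNegative-real : 0ℚ ≤ D → y ≈ᴿ 0ᴿ
    root-of-nonNegative-real 0≤D = ¬apart⇒≈0 y λ apart →
      let 0<-D = Pos-fromℚ⁻¹ (Pos-resp {y *ᴿ y} {fromℚ (- D)} (im-square≈ apart) (apart⇒Pos-square y apart))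
      in ℚ.<-irrefl refl (ℚ.<-≤-trans 0<-D (ℚ.neg-antimono-≤ 0≤D))

    -- Here y² ≈ - D + x² with x² nonnegative term by term, so y² is positive and y is apart from 0.
    -- The sign of y decides which of x + y i and its negative has positive imaginary part.
    root-of-negative-imaginary : D < 0ℚ → ∃[ s ] (Pos s × s *ᴿ s ≈ᴿ fromℚ (- D) ×
      ((x +i y) ≈ fromℝ s *ᶜ 𝕚 ⊎ ((-ᴿ x) +i (-ᴿ y)) ≈ fromℝ s *ᶜ 𝕚))
    root-of-negative-imaginary D<0 = choose apart
      where
      apart : Pos y ⊎ Pos (-ᴿ y)
      apart = Pos-square⁻¹ y (Pos-resp {fromℚ (- D) +ᴿ x *ᴿ x} {y *ᴿ y}
        (≈ᴿ-sym {y *ᴿ y} {fromℚ (- D) +ᴿ x *ᴿ x} (ℝ-Algebra.isolate-square x y D re-square))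
        (Pos-+-nonNeg {fromℚ (- D)} {x *ᴿ x} (Pos-fromℚ (ℚ.neg-antimono-< D<0)) (0 , λ n _ → 0≤p*p (seq x n))))

      -x≈0 : -ᴿ x ≈ᴿ 0ᴿ
      -x≈0 = mk≈ᴿ (close (-ᴿ-cong {x} {0ᴿ} (re≈0 apart)))

      choose : Pos y ⊎ Pos (-ᴿ y) → ∃[ s ] (Pos s × s *ᴿ s ≈ᴿ fromℚ (- D) ×
        ((x +i y) ≈ fromℝ s *ᶜ 𝕚 ⊎ ((-ᴿ x) +i (-ᴿ y)) ≈ fromℝ s *ᶜ 𝕚))
      choose (inj₁ y>0) = y , y>0 , im-square≈ apart , inj₁ (fromℝ-*-𝕚 x y (re≈0 apart))
      choose (inj₂ y<0) = -ᴿ y , y<0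
        , ≈ᴿ-trans { -ᴿ y *ᴿ -ᴿ y} {y *ᴿ y} {fromℚ (- D)} (ℝ-Algebra.neg-square y) (im-square≈ apart)
        , inj₂ (fromℝ-*-𝕚 (-ᴿ x) (-ᴿ y) -x≈0)

-- Generators of imaginary quadratic fields.

module Fields where

  open import Data.Integer.Base using (+_; -[1+_])
  open import Data.Rational.Base using (_+_; _*_; -_; _<_)
  open ≡ using (refl; sym; trans; cong₂; subst; module ≡-Reasoning)
  open CauchyLemmas using (0<1)
  open ComplexNumbers
  open _≈ᴿ_
  open _≈_

  private variable
    ℓ : Level

  int : ℤ → ℚ
  int i = i ℚ./ 1

  -- Integer arithmetic inside ℚ is checked on unnormalised fractions, where no common divisor has
  -- to be cancelled.
  toℚᵘ-int : ∀ i → toℚᵘ (int i) ≃ mkℚᵘ i 0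
  toℚᵘ-int i = ℚ.toℚᵘ-fromℚᵘ (mkℚᵘ i 0)

  int-+ : ∀ i j → int (i ℤ.+ j) ≡ int i + int j
  int-+ i j = ℚ.toℚᵘ-injective (begin-equality
    toℚᵘ (int (i ℤ.+ j))              ≃⟨ toℚᵘ-int (i ℤ.+ j) ⟩
    mkℚᵘ (i ℤ.+ j) 0                  ≃⟨ *≡* (cong (ℤ._* + 1) (cong₂ ℤ._+_ (ℤ.*-identityʳ i) (ℤ.*-identityʳ j))) ⟨
    mkℚᵘ i 0 ℚᵘ.+ mkℚᵘ j 0            ≃⟨ ℚᵘ.+-cong (toℚᵘ-int i) (toℚᵘ-int j) ⟨
    toℚᵘ (int i) ℚᵘ.+ toℚᵘ (int j)    ≃⟨ ℚ.toℚᵘ-homo-+ (int i) (int j) ⟨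
    toℚᵘ (int i + int j)              ∎)
    where open ℚᵘ.≤-Reasoning

  int-* : ∀ i j → int (i ℤ.* j) ≡ int i * int j
  int-* i j = ℚ.toℚᵘ-injective (begin-equality
    toℚᵘ (int (i ℤ.* j))              ≃⟨ toℚᵘ-int (i ℤ.* j) ⟩
    mkℚᵘ i 0 ℚᵘ.* mkℚᵘ j 0            ≃⟨ ℚᵘ.*-cong (toℚᵘ-int i) (toℚᵘ-int j) ⟨
    toℚᵘ (int i) ℚᵘ.* toℚᵘ (int j)    ≃⟨ ℚ.toℚᵘ-homo-* (int i) (int j) ⟨
    toℚᵘ (int i * int j)              ∎)
    where open ℚᵘ.≤-Reasoning

  *-denominator : ∀ p → p * int (↧ p) ≡ int (↥ p)
  *-denominator p@(mkℚ n d-1 _) = ℚ.toℚᵘ-injective (begin-equality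
    toℚᵘ (p * int (↧ p))              ≃⟨ ℚ.toℚᵘ-homo-* p (int (↧ p)) ⟩
    toℚᵘ p ℚᵘ.* toℚᵘ (int (↧ p))      ≃⟨ ℚᵘ.*-congˡ {toℚᵘ p} (toℚᵘ-int (↧ p)) ⟩
    mkℚᵘ n d-1 ℚᵘ.* mkℚᵘ (↧ p) 0      ≃⟨ *≡* (trans (ℤ.*-identityʳ (n ℤ.* ↧ p))
                                           (cong (λ m → n ℤ.* + m) (sym (ℕ.*-identityʳ (suc d-1))))) ⟩
    mkℚᵘ n 0                          ≃⟨ toℚᵘ-int n ⟨
    toℚᵘ (int (↥ p))                  ∎)
    where open ℚᵘ.≤-Reasoning

  int-positive : ∀ {n} → 0 ℕ.< n → 0ℚ < int (+ n)
  int-positive {suc n} _ = ℚ.toℚᵘ-cancel-< (ℚᵘ.<-respʳ-≃ (ℚᵘ.≃-sym (toℚᵘ-int (+ suc n)))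
    (ℚᵘ.positive⁻¹ (mkℚᵘ (+ suc n) 0)))

  1≉0 : ¬ (1ᶜ ≈ 0ᶜ)
  1≉0 1≈0 = Pos⇒≉0 {1ᴿ} (Pos-fromℚ 0<1) (re≈ 1≈0)

  ι-injective-0 : ∀ {q} → 0ℚ < q → ¬ (ι q ≈ 0ᶜ)
  ι-injective-0 {q} 0<q q≈0 = Pos⇒≉0 {fromℚ q} (Pos-fromℚ 0<q) (re≈ q≈0)

  module _ {K : Pred ℂ ℓ} (F : IsSubfield K) where

    private module F = IsSubfield F

    natural∈ : ∀ n → ι (int (+ n)) ∈ K
    natural∈ zero    = F.0∈
    natural∈ (suc n) = subst (λ q → ι q ∈ K) (sym (int-+ (+ 1) (+ n)))
      (F.resp {ι 1ℚ +ᶜ ι (int (+ n))} {ι (1ℚ + int (+ n))}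
        (≈-sym {ι (1ℚ + int (+ n))} {ι 1ℚ +ᶜ ι (int (+ n))} (ι-+ 1ℚ (int (+ n))))
        (F.+-closed {ι 1ℚ} {ι (int (+ n))} F.1∈ (natural∈ n)))

    integer∈ : ∀ i → ι (int i) ∈ K
    integer∈ (+ n)      = natural∈ n
    integer∈ (-[1+ n ]) = F.resp { -ᶜ ι (int (+ suc n))} {ι (- int (+ suc n))}
      (≈-sym {ι (- int (+ suc n))} { -ᶜ ι (int (+ suc n))} (ι-neg (int (+ suc n))))
      (F.neg-closed {ι (int (+ suc n))} (natural∈ (suc n)))

    rational∈ : ∀ p → ι p ∈ K
    rational∈ p@(mkℚ _ d-1 _) =
      let w , w∈K , bw≈1 = F.inverse {ι (int (↧ p))} (integer∈ (↧ p)) (ι-injective-0 (int-positive {suc d-1} (ℕ.s≤s ℕ.z≤n)))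
      in F.resp {ι (int (↥ p)) *ᶜ w} {ι p}
           (ℂ-Algebra.divide p (int (↧ p)) (int (↥ p)) w (*-denominator p) bw≈1)
           (F.*-closed {ι (int (↥ p))} {w} (integer∈ (↥ p)) w∈K)

  -- That is, K = ℚ + ℚ w. In this linear form, a change of generator is a computation with two
  -- rational coefficients.
  Generates : Pred ℂ ℓ → ℂ → Set ℓ
  Generates K w = w ∈ K × (∀ z → z ∈ K → ∃[ p ] ∃[ q ] z ≈ ι p +ᶜ ι q *ᶜ w)

  ι-rational : ∀ {w} p → ι p ∈ ℚ⟮ w ⟯
  ι-rational p = rational p

  Generates⇒primitive : {K : Pred ℂ ℓ} → IsSubfield K → ∀ w → Generates K w → w IsPrimitiveElementOf K
  Generates⇒primitive {K = K} F w (w∈K , span) = (λ {z} → adjoin⊆ z) , (λ {z} → ⊆adjoin z)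
    where
    module F = IsSubfield F

    ⊆adjoin : ∀ z → z ∈ K → z ∈ ℚ⟮ w ⟯
    ⊆adjoin z z∈K =
      let p , q , eq = span z z∈K
      in respects {u = ι p +ᶜ ι q *ᶜ w} {v = z} (≈-sym {z} {ι p +ᶜ ι q *ᶜ w} eq)
           (sum {u = ι p} {v = ι q *ᶜ w} (ι-rational p) (product {u = ι q} {v = w} (ι-rational q) generator))

    adjoin⊆ : ∀ z → z ∈ ℚ⟮ w ⟯ → z ∈ K
    adjoin⊆ _ (rational q)             = rational∈ F q
    adjoin⊆ _ generator                = w∈K
    adjoin⊆ _ (sum {u} {v} u∈ v∈)      = F.+-closed {u} {v} (adjoin⊆ u u∈) (adjoin⊆ v v∈)
    adjoin⊆ _ (negative {u} u∈)        = F.neg-closed {u} (adjoin⊆ u u∈)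
    adjoin⊆ _ (product {u} {v} u∈ v∈)  = F.*-closed {u} {v} (adjoin⊆ u u∈) (adjoin⊆ v v∈)
    -- K provides an inverse u′ of its own, since u v ≈ 1 prevents u from being 0; uniqueness of
    -- inverses identifies it with v.
    adjoin⊆ _ (inverse {u} {v} u∈ uv≈1) =
      let u′ , u′∈K , uu′≈1 = F.inverse {u} (adjoin⊆ u u∈) (λ u≈0 → 1≉0 (ℂ-Algebra.zero-not-invertible u v u≈0 uv≈1))
      in F.resp {u′} {v} (ℂ-Algebra.inverse-unique u u′ v uu′≈1 uv≈1) u′∈K
    adjoin⊆ _ (respects {u} {v} u≈v u∈) = F.resp {u} {v} u≈v (adjoin⊆ u u∈)

  Generates-scale : {K : Pred ℂ ℓ} → IsSubfield K → ∀ w w′ r u → u * r ≡ 1ℚ → w′ ≈ ι r *ᶜ w →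
                    Generates K w → Generates K w′
  Generates-scale F w w′ r u ur≡1 w′≈ (w∈K , span) =
      F.resp {ι r *ᶜ w} {w′} (≈-sym {w′} {ι r *ᶜ w} w′≈) (F.*-closed {ι r} {w} (rational∈ F r) w∈K)
    , λ z z∈K → let p , q , eq = span z z∈K
                in p , q * u , ℂ-Algebra.rescale-generator w w′ z p q r u ur≡1 w′≈ eq
    where module F = IsSubfield F

  ∑₂ : ∀ (h : Vector ℂ 2) → ∑ h ≈ h zero +ᶜ h (suc zero)
  ∑₂ h = pointwiseᶜ (∑ h) (h zero +ᶜ h (suc zero))
    (λ n → cong (λ t → seq (re (h zero)) n + t) (ℚ.+-identityʳ (seq (re (h (suc zero))) n)))
    (λ n → cong (λ t → seq (im (h zero)) n + t) (ℚ.+-identityʳ (seq (im (h (suc zero))) n)))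

  linComb₂ : ∀ (q : Vector ℚ 2) b → linComb q b ≈ ι (q zero) *ᶜ b zero +ᶜ ι (q (suc zero)) *ᶜ b (suc zero)
  linComb₂ q b = ≈-trans {linComb q b}
    {fromℝ (fromℚ (q zero)) *ᶜ b zero +ᶜ fromℝ (fromℚ (q (suc zero))) *ᶜ b (suc zero)}
    {ι (q zero) *ᶜ b zero +ᶜ ι (q (suc zero)) *ᶜ b (suc zero)}
    (∑₂ (λ i → fromℝ (fromℚ (q i)) *ᶜ b i))
    (pointwiseᶜ (fromℝ (fromℚ (q zero)) *ᶜ b zero +ᶜ fromℝ (fromℚ (q (suc zero))) *ᶜ b (suc zero))
      (ι (q zero) *ᶜ b zero +ᶜ ι (q (suc zero)) *ᶜ b (suc zero)) (λ _ → refl) (λ _ → refl))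

  +ᶜ-comm : ∀ x y → x +ᶜ y ≈ y +ᶜ x
  +ᶜ-comm x y = pointwiseᶜ (x +ᶜ y) (y +ᶜ x)
    (λ n → ℚ.+-comm (seq (re x) n) (seq (re y) n)) (λ n → ℚ.+-comm (seq (im x) n) (seq (im y) n))

  -- As q is invertible, the relation for 1 expresses b through 1 and c, so b can be exchanged for
  -- 1.
  eliminate-generator : {K : Pred ℂ ℓ} → ∀ b c q q′ → q ≢ 0ℚ → 1ᶜ ≈ ι q *ᶜ b +ᶜ ι q′ *ᶜ c → c ∈ K →
    (∀ z → z ∈ K → ∃[ p ] ∃[ p′ ] z ≈ ι p *ᶜ b +ᶜ ι p′ *ᶜ c) → Generates K c
  eliminate-generator b c q q′ q≢0 one c∈K span = c∈K , λ z z∈K →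
    let p , p′ , eq = span z z∈K
    in p * u , p′ + - (p * u * q′)
     , ≈-trans {z} {ι p *ᶜ b +ᶜ ι p′ *ᶜ c} {ι (p * u) +ᶜ ι (p′ + - (p * u * q′)) *ᶜ c} eq
         (ℂ-Algebra.eliminate b c p p′ q q′ u (ℚ.*-inverseʳ q) one)
    where
    instance
      nonZero : ℚ.NonZero q
      nonZero = ℚ.≢-nonZero q≢0
    u = ℚ.1/ q

  -- The given basis may not contain 1. The coordinates of 1 are rational, so it is decidable which
  -- of them vanish; not both do, and a basis vector with nonzero coordinate is exchanged for 1.
  quadratic-generator : {K : Pred ℂ ℓ} → IsSubfield K → HasDegree K 2 → ∃[ α ] Generates K α
  quadratic-generator {K = K} F (b , basis) =
    let q₀ , q₁ , one = span 1ᶜ (IsSubfield.1∈ F) in cases q₀ q₁ one (q₀ ℚ.≟ 0ℚ) (q₁ ℚ.≟ 0ℚ)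
    where
    open IsℚBasis basis

    swap : ∀ z p₀ p₁ → z ≈ ι p₀ *ᶜ b zero +ᶜ ι p₁ *ᶜ b (suc zero) → z ≈ ι p₁ *ᶜ b (suc zero) +ᶜ ι p₀ *ᶜ b zero
    swap z p₀ p₁ eq = ≈-trans {z} {ι p₀ *ᶜ b zero +ᶜ ι p₁ *ᶜ b (suc zero)} {ι p₁ *ᶜ b (suc zero) +ᶜ ι p₀ *ᶜ b zero}
      eq (+ᶜ-comm (ι p₀ *ᶜ b zero) (ι p₁ *ᶜ b (suc zero)))

    span : ∀ z → z ∈ K → ∃[ p₀ ] ∃[ p₁ ] z ≈ ι p₀ *ᶜ b zero +ᶜ ι p₁ *ᶜ b (suc zero)
    span z z∈K =
      let p , eq = spanning {z} z∈K
      in p zero , p (suc zero)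
       , ≈-trans {z} {linComb p b} {ι (p zero) *ᶜ b zero +ᶜ ι (p (suc zero)) *ᶜ b (suc zero)} eq (linComb₂ p b)

    cases : ∀ q₀ q₁ → 1ᶜ ≈ ι q₀ *ᶜ b zero +ᶜ ι q₁ *ᶜ b (suc zero) → Dec (q₀ ≡ 0ℚ) → Dec (q₁ ≡ 0ℚ) → ∃[ α ] Generates K α
    cases _ _ one (yes refl) (yes refl) = contradiction
      (≈-trans {1ᶜ} {ι 0ℚ *ᶜ b zero +ᶜ ι 0ℚ *ᶜ b (suc zero)} {0ᶜ} one
        (ℂ-Algebra.zero-combination (b zero) (b (suc zero))))
      1≉0
    cases q₀ q₁ one (no q₀≢0) _ = b (suc zero) ,
      eliminate-generator (b zero) (b (suc zero)) q₀ q₁ q₀≢0 one (members (suc zero)) span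
    cases q₀ q₁ one (yes _) (no q₁≢0) = b zero ,
      eliminate-generator (b (suc zero)) (b zero) q₁ q₀ q₁≢0 (swap 1ᶜ q₀ q₁ one) (members zero)
        (λ z z∈K → let p₀ , p₁ , eq = span z z∈K in p₁ , p₀ , swap z p₀ p₁ eq)

  -- Spanning gives α² = p + r α; the shift of α by - r / 2 completes the square.
  depressed-generator : {K : Pred ℂ ℓ} → IsSubfield K → ∀ α → Generates K α →
    ∃[ β ] ∃[ D ] (β *ᶜ β ≈ ι D × Generates K β)
  depressed-generator {K = K} F α (α∈K , span) =
    let p , r , α² = span (α *ᶜ α) (F.*-closed {α} {α} α∈K α∈K)
        s = - ½ * r
    in α +ᶜ ι s , p + ½ * r * (½ * r) , ℂ-Algebra.completed-square α p r α²
     , F.+-closed {α} {ι s} α∈K (rational∈ F s)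
     , λ z z∈K → let a , c , eq = span z z∈K in a + - (c * s) , c , ℂ-Algebra.translate α z a c s eq
    where module F = IsSubfield F

  real-generator⇒⊆IsReal : {K : Pred ℂ ℓ} → ∀ β → Generates K β → IsReal β → K ⊆ IsReal
  real-generator⇒⊆IsReal β (_ , span) β-real {z} z∈K =
    let p , q , eq = span z z∈K
    in ≈ᴿ-trans {im z} {0ᴿ +ᴿ (fromℚ q *ᴿ im β +ᴿ 0ᴿ *ᴿ re β)} {0ᴿ} (mk≈ᴿ (close (im≈ eq)))
         (ℝ-Algebra.affine-zero (fromℚ q) (re β) (im β) β-real)

  oriented-generator : {K : Pred ℂ ℓ} → IsSubfield K → ∀ β s →
    ((re β +i im β) ≈ fromℝ s *ᶜ 𝕚 ⊎ ((-ᴿ re β) +i (-ᴿ im β)) ≈ fromℝ s *ᶜ 𝕚) →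
    Generates K β → Generates K (fromℝ s *ᶜ 𝕚)
  oriented-generator F β s (inj₁ eq) = Generates-scale F β (fromℝ s *ᶜ 𝕚) 1ℚ 1ℚ refl
    (ℂ-Algebra.scale-by-one β (fromℝ s *ᶜ 𝕚) (mk≈ (mk≈ᴿ (close (re≈ eq))) (mk≈ᴿ (close (im≈ eq)))))
  oriented-generator F β s (inj₂ eq) = Generates-scale F β (fromℝ s *ᶜ 𝕚) (- 1ℚ) (- 1ℚ) refl
    (ℂ-Algebra.scale-by-minus-one β (fromℝ s *ᶜ 𝕚) (mk≈ (mk≈ᴿ (close (re≈ eq))) (mk≈ᴿ (close (im≈ eq)))))

  -- The sign of the rational number D is decidable. If D ≥ 0, then β and with it all of K would be
  -- real; if D < 0, then β or its negative is s √-1 with s positive.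
  purely-imaginary-generator : {K : Pred ℂ ℓ} → IsSubfield K → ¬ (K ⊆ IsReal) → ∀ β D → β *ᶜ β ≈ ι D → Generates K β →
    ∃[ s ] (0ℚ < - D × Pos s × s *ᴿ s ≈ᴿ fromℚ (- D) × Generates K (fromℝ s *ᶜ 𝕚))
  purely-imaginary-generator {K = K} F imaginary β D β² gen = cases (D ℚ.<? 0ℚ)
    where
    re-β² : re β *ᴿ re β +ᴿ -ᴿ (im β *ᴿ im β) ≈ᴿ fromℚ D
    re-β² = mk≈ᴿ (close (re≈ β²))

    im-β² : re β *ᴿ im β +ᴿ im β *ᴿ re β ≈ᴿ 0ᴿ
    im-β² = mk≈ᴿ (close (im≈ β²))

    cases : Dec (D < 0ℚ) → ∃[ s ] (0ℚ < - D × Pos s × s *ᴿ s ≈ᴿ fromℚ (- D) × Generates K (fromℝ s *ᶜ 𝕚))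
    cases (no D≮0) = contradiction
      (λ {z} → real-generator⇒⊆IsReal β gen
        (root-of-nonNegative-real (re β) (im β) D re-β² im-β² (ℚ.≮⇒≥ D≮0)) {z})
      imaginary
    cases (yes D<0) =
      let s , s>0 , s² , eq = root-of-negative-imaginary (re β) (im β) D re-β² im-β² D<0
      in s , ℚ.neg-antimono-< D<0 , s>0 , s² , oriented-generator F β s eq gen

  ι-*-𝕚 : ∀ r s → fromℝ (fromℚ r *ᴿ s) *ᶜ 𝕚 ≈ ι r *ᶜ (fromℝ s *ᶜ 𝕚)
  ι-*-𝕚 r s = pointwiseᶜ (fromℝ (fromℚ r *ᴿ s) *ᶜ 𝕚) (ι r *ᶜ (fromℝ s *ᶜ 𝕚))
    (λ n → scaled-𝕚-re r (seq s n)) (λ n → scaled-𝕚-im r (seq s n))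

  Generates-ι-*-𝕚 : {K : Pred ℂ ℓ} → IsSubfield K → ∀ r s → 0ℚ < r →
    Generates K (fromℝ s *ᶜ 𝕚) → Generates K (fromℝ (fromℚ r *ᴿ s) *ᶜ 𝕚)
  Generates-ι-*-𝕚 F r s 0<r = Generates-scale F (fromℝ s *ᶜ 𝕚) (fromℝ (fromℚ r *ᴿ s) *ᶜ 𝕚) r (ℚ.1/ r)
    (ℚ.*-inverseˡ r) (ι-*-𝕚 r s)
    where
    instance
      nonZero : ℚ.NonZero r
      nonZero = ℚ.pos⇒nonZero r {{ℚ.positive 0<r}}

  Pos-fromℚ-* : ∀ {r s} → 0ℚ < r → Pos s → Pos (fromℚ r *ᴿ s)
  Pos-fromℚ-* {r} {s} 0<r s>0 = Pos-* {fromℚ r} {s} (Pos-fromℚ 0<r) s>0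

  clear-denominator : ∀ δ → 0ℚ < δ → ∃[ d ] (0 ℕ.< d × ∃[ b ] (0ℚ < b × b * b * δ ≡ int (+ d)))
  clear-denominator (mkℚ -[1+ _ ] _ _) 0<δ = contradiction (ℚ.positive 0<δ) λ ()
  clear-denominator (mkℚ (+ zero) _ _) 0<δ = contradiction (ℚ.positive 0<δ) λ ()
  clear-denominator δ@(mkℚ (+ suc a) b-1 _) _ =
    -- For δ = a / b, multiplication by b² leaves the integer a b.
    suc b-1 ℕ.* suc a , ℕ.s≤s ℕ.z≤n , int (↧ δ) , int-positive {suc b-1} (ℕ.s≤s ℕ.z≤n) , (begin
      int (↧ δ) * int (↧ δ) * δ      ≡⟨ ℚ.*-assoc (int (↧ δ)) (int (↧ δ)) δ ⟩
      int (↧ δ) * (int (↧ δ) * δ)    ≡⟨ cong (int (↧ δ) *_) (trans (ℚ.*-comm (int (↧ δ)) δ) (*-denominator δ)) ⟩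
      int (↧ δ) * int (+ suc a)      ≡⟨ int-* (↧ δ) (+ suc a) ⟨
      int (↧ δ ℤ.* + suc a)          ≡⟨⟩
      int (+ (suc b-1 ℕ.* suc a))    ∎)
    where open ≡-Reasoning

  -- K is generated by √-d = s √-1.
  record ImaginaryGenerator (K : Pred ℂ ℓ) : Set ℓ where
    constructor mkGenerator
    field
      d         : ℕ
      0<d       : 0 ℕ.< d
      s         : ℝ
      s>0       : Pos s
      s²        : s *ᴿ s ≈ᴿ fromℤ (+ d)
      generates : Generates K (fromℝ s *ᶜ 𝕚)

  imaginary-quadratic-generator : (L : ImaginaryQuadraticField ℓ) → ImaginaryGenerator (carrier L)
  imaginary-quadratic-generator L =
    let α , α-gen                   = quadratic-generator isSubfield quadratic
        β , D , β² , β-gen          = depressed-generator isSubfield α α-gen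
        s , 0<δ , s>0 , s² , s-gen  = purely-imaginary-generator isSubfield imaginary β D β² β-gen
        d , 0<d , b , 0<b , b²δ≡d   = clear-denominator (- D) 0<δ
    in mkGenerator d 0<d (fromℚ b *ᴿ s) (Pos-fromℚ-* {b} {s} 0<b s>0)
         (subst (λ q → (fromℚ b *ᴿ s) *ᴿ (fromℚ b *ᴿ s) ≈ᴿ fromℚ q) b²δ≡d (ℝ-Algebra.scaled-square s (- D) b s²))
         (Generates-ι-*-𝕚 isSubfield b s 0<b s-gen)
    where open ImaginaryQuadraticField L hiding (carrier)

  scaled-integer-square : ∀ s d b → s *ᴿ s ≈ᴿ fromℤ (+ d) →
    (fromℚ (int (+ b)) *ᴿ s) *ᴿ (fromℚ (int (+ b)) *ᴿ s) ≈ᴿ fromℤ (+ (b ℕ.* b ℕ.* d))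
  scaled-integer-square s d b s² = subst (λ q → (fromℚ (int (+ b)) *ᴿ s) *ᴿ (fromℚ (int (+ b)) *ᴿ s) ≈ᴿ fromℚ q)
    (sym (begin
      int (+ (b ℕ.* b ℕ.* d))                  ≡⟨ cong int (ℤ.pos-* (b ℕ.* b) d) ⟩
      int (+ (b ℕ.* b) ℤ.* + d)                ≡⟨ int-* (+ (b ℕ.* b)) (+ d) ⟩
      int (+ (b ℕ.* b)) * int (+ d)            ≡⟨ cong (λ i → int i * int (+ d)) (ℤ.pos-* b b) ⟩
      int (+ b ℤ.* + b) * int (+ d)            ≡⟨ cong (_* int (+ d)) (int-* (+ b) (+ b)) ⟩
      int (+ b) * int (+ b) * int (+ d)        ∎))
    (ℝ-Algebra.scaled-square s (int (+ d)) (int (+ b)) s²)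
    where open ≡-Reasoning

  rational-multiple-generates-𝕚 : {K : Pred ℂ ℓ} → IsSubfield K → ∀ t r → 0ℚ < r → t ≈ᴿ fromℚ r →
    Generates K (fromℝ t *ᶜ 𝕚) → Generates K 𝕚
  rational-multiple-generates-𝕚 F t r 0<r t≈r =
    Generates-scale F (fromℝ t *ᶜ 𝕚) 𝕚 (ℚ.1/ r) r (ℚ.*-inverseʳ r)
      (≈-sym {ι (ℚ.1/ r) *ᶜ (fromℝ t *ᶜ 𝕚)} {𝕚}
        (≈-trans {ι (ℚ.1/ r) *ᶜ (fromℝ t *ᶜ 𝕚)} {ι (ℚ.1/ r) *ᶜ (ι r *ᶜ 𝕚)} {𝕚}
          (*ᶜ-cong {ι (ℚ.1/ r)} {ι (ℚ.1/ r)} {fromℝ t *ᶜ 𝕚} {ι r *ᶜ 𝕚} (≈-refl {ι (ℚ.1/ r)})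
            (*ᶜ-cong {fromℝ t} {ι r} {𝕚} {𝕚} (mk≈ t≈r (≈ᴿ-refl {0ᴿ})) (≈-refl {𝕚})))
          (ℂ-Algebra.cancel-scale (ℚ.1/ r) r 𝕚 (ℚ.*-inverseˡ r))))
    where
    instance
      nonZero : ℚ.NonZero r
      nonZero = ℚ.pos⇒nonZero r {{ℚ.positive 0<r}}

  -- From b² d = a² follows (b s)² ≈ a², and both b s and a are positive, so b s ≈ a and s is
  -- rational. In this way K ≠ ℚ(√-1) becomes the irrationality of √d.
  square⇒generates-𝕚 : {K : Pred ℂ ℓ} → IsSubfield K → ∀ s d a b → Pos s → s *ᴿ s ≈ᴿ fromℤ (+ d) →
    0 ℕ.< a → 0 ℕ.< b → b ℕ.* b ℕ.* d ≡ a ℕ.* a → Generates K (fromℝ s *ᶜ 𝕚) → Generates K 𝕚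
  square⇒generates-𝕚 F s d a b s>0 s² 0<a 0<b eq gen =
    rational-multiple-generates-𝕚 F (fromℚ (int (+ b)) *ᴿ s) (int (+ a)) (int-positive 0<a)
      (rational-square-root (fromℚ (int (+ b)) *ᴿ s) (int (+ a))
        (Pos-fromℚ-* {int (+ b)} {s} (int-positive 0<b) s>0) (int-positive 0<a)
        (subst (λ q → (fromℚ (int (+ b)) *ᴿ s) *ᴿ (fromℚ (int (+ b)) *ᴿ s) ≈ᴿ fromℚ q)
          (trans (cong (λ n → int (+ n)) eq) (trans (cong int (ℤ.pos-* a a)) (int-* (+ a) (+ a))))
          (scaled-integer-square s d b s²)))
      (Generates-ι-*-𝕚 F (int (+ b)) s (int-positive 0<b) gen)

-- Primitive elements in the sets `I²ⁱ`.

open import Data.Integer.Base using (+_)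
open import Data.Nat.Base using (_*_; _<_)
open ≡ using (refl; sym; trans; subst)
open SquareGaps using (simultaneous-square-gap)
open ComplexNumbers
open Fields
open Fields.ImaginaryGenerator

private variable
  ℓ : Level

I²ⁱ-intro : ∀ n c t → Pos t → t *ᴿ t ≈ᴿ fromℤ (+ c) → n * n < c → c < suc n * suc n → fromℝ t *ᶜ 𝕚 ∈ I²ⁱ (2 * n)
I²ⁱ-intro n c t t>0 t² lower upper =
    -- The imaginary part of t √-1 has the terms t * 1 + 0 * 0, which equal those of t.
    (λ real → Pos⇒≉0 {t} t>0 (mk≈ᴿ λ ε 0<ε → let N , h = _≈ᴿ_.close real ε 0<ε in N , λ m p →
      subst (λ x → ℚ.∣ x ℚ.- 0ℚ ∣ ℚ.< ε) (trans (ℚ.+-identityʳ (seq t m ℚ.* ℚ.1ℚ)) (ℚ.*-identityʳ (seq t m))) (h m p)))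
  , + c
  , ℤ.+<+ (subst (_< c) (sym (trans (cong (ℕ._^ 2) half) (square n))) lower)
  , ℤ.+<+ (subst (c <_) (sym (trans (cong (λ h → (h ℕ.+ 1) ℕ.^ 2) half)
                               (trans (cong (ℕ._^ 2) (ℕ.+-comm n 1)) (square (suc n))))) upper)
  , t , (Pos⇒0≤ {t} t>0 , t²) , ≈-refl {fromℝ t *ᶜ 𝕚}
  where
  half : 2 * n ℕ./ 2 ≡ n
  half = trans (cong (ℕ._/ 2) (ℕ.*-comm 2 n)) (m*n/n≡m n 2)

  square : ∀ m → m ℕ.^ 2 ≡ m * m
  square m = cong (m *_) (ℕ.*-identityʳ m)

module _ {K : Pred ℂ ℓ} (F : IsSubfield K) (G : ImaginaryGenerator K) where

  nonsquare : ¬ (K ≐ ℚ⟮ 𝕚 ⟯) → ∀ a b → b * b * d G ≡ a * a → a ≡ 0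
  nonsquare K≢ℚ𝕚 0       b       eq = refl
  nonsquare K≢ℚ𝕚 (suc a) (suc b) eq = contradiction
    (Product.swap (Generates⇒primitive F 𝕚
      (square⇒generates-𝕚 F (s G) (d G) (suc a) (suc b) (s>0 G) (s² G) (ℕ.s≤s ℕ.z≤n) (ℕ.s≤s ℕ.z≤n) eq (generates G))))
    K≢ℚ𝕚

  primitive-element : ∀ n b → n * n < b * b * d G → b * b * d G < suc n * suc n →
    ∃[ z ] (z ∈ I²ⁱ (2 * n) × z IsPrimitiveElementOf K)
  -- The case b = 0 is ruled out by `lower`.
  primitive-element n b@(suc _) lower upper =
      fromℝ (fromℚ (int (+ b)) *ᴿ s G) *ᶜ 𝕚
    , I²ⁱ-intro n (b * b * d G) (fromℚ (int (+ b)) *ᴿ s G) (Pos-fromℚ-* {int (+ b)} {s G} 0<b (s>0 G))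
        (scaled-integer-square (s G) (d G) b (s² G)) lower upper
    , Generates⇒primitive F (fromℝ (fromℚ (int (+ b)) *ᴿ s G) *ᶜ 𝕚)
        (Generates-ι-*-𝕚 F (int (+ b)) (s G) 0<b (generates G))
    where
    0<b : 0ℚ ℚ.< int (+ b)
    0<b = int-positive {b} (ℕ.s≤s ℕ.z≤n)

theorem9 : ∀ {ℓ : Level} (k : ℕ) → 0 < k →
    (K : Fin k → ImaginaryQuadraticField ℓ) →
    (∀ i j → i ≢ j → ¬ (carrier (K i) ≐ carrier (K j))) →
    (∀ i → ¬ (carrier (K i) ≐ ℚ⟮ 𝕚 ⟯)) →
    ∃[ n ] (0 < n × (∀ i → ∃[ z ] (z ∈ I²ⁱ (2 * n) × z IsPrimitiveElementOf carrier (K i))))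
theorem9 (suc k) _ K _ K≢ℚ𝕚 = assemble (λ i → imaginary-quadratic-generator (K i))
  where
  F : ∀ i → IsSubfield (carrier (K i))
  F i = ImaginaryQuadraticField.isSubfield (K i)

  assemble : (∀ i → ImaginaryGenerator (carrier (K i))) →
    ∃[ n ] (0 < n × (∀ i → ∃[ z ] (z ∈ I²ⁱ (2 * n) × z IsPrimitiveElementOf carrier (K i))))
  assemble G = conclude (simultaneous-square-gap (λ i → d (G i)) (λ i → 0<d (G i)) (λ i → nonsquare (F i) (G i) (K≢ℚ𝕚 i)))
    where
    conclude : ∃[ n ] (∀ i → ∃[ b ] (n * n < b * b * d (G i) × b * b * d (G i) < suc n * suc n)) →
      ∃[ n ] (0 < n × (∀ i → ∃[ z ] (z ∈ I²ⁱ (2 * n) × z IsPrimitiveElementOf carrier (K i))))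
    -- For n = 0 a natural number would lie strictly between 0 and 1; the index `zero` exists
    -- because k is positive.
    conclude (0     , gap) = let _ , lower , upper = gap zero in contradiction upper (ℕ.≤⇒≯ lower)
    conclude (suc n , gap) = suc n , ℕ.s≤s ℕ.z≤n , λ i →
      let b , lower , upper = gap i in primitive-element (F i) (G i) (suc n) b lower upper
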